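{- Let $M_6$ be the simple graph on $6$ vertices whose complement is the disjoint union of two paths on $3$ vertices each (so $M_6$ has $11$ edges). Then $M_6$ is a smallest non-autograph: $M_6$ is not an autograph, while every simple graph with at most $5$ vertices is an autograph.
   Context: Let $G=(V,E)$ be a finite simple graph and $S$ a finite multiset of integers. $G$ is an autograph with signature $S$ if there is a bijection $\pi$ from the elements of $S$ (counted with multiplicity) to $V$ such that for any two distinct elements $s,t$ of $S$, the vertices $\pi(s),\pi(t)$ are adjacent if and only if $|s-t|\in S$. A graph is a non-autograph if it admits no signature. -}

module Defs where

open import Data.Bool using (Bool; true; false)
open import Data.Nat using (ℕ)
open import Data.Fin using (Fin; zero; suc)
open import Data.Integer using (ℤ; +_; _-_; ∣_∣)
open import Data.Product using (Σ; ∃; ∃-syntax; _×_; _,_)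
open import Function.Bundles using (_⤖_; _⇔_; Bijection)
open import Relation.Binary.PropositionalEquality using (_≡_; _≢_; refl)

record Graph (n : ℕ) : Set where
  field
    adj    : Fin n → Fin n → Bool
    sym    : ∀ i j → adj i j ≡ adj j i
    irrefl : ∀ i → adj i i ≡ false
open Graph public

-- Signatures.  A finite multiset S of integers is given by listing its
-- elements with multiplicity: S : Fin m → ℤ (position k holds the k-th
-- element).  A bijection π from the elements of S to V = Fin n is a
-- bijection Fin m ⤖ Fin n (so m = n necessarily).  Condition: for any two
-- distinct elements (distinct positions i ≢ j) of S, the vertices π i, π j
-- are adjacent iff ∣ S i - S j ∣ ∈ S.
_∈S_ : {m : ℕ} → ℤ → (Fin m → ℤ) → Set
x ∈S S = ∃[ k ] S k ≡ x

IsSignature : {n m : ℕ} → Graph n → (S : Fin m → ℤ) → (π : Fin m ⤖ Fin n) → Set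
IsSignature {n} {m} G S π =
  ∀ (i j : Fin m) → i ≢ j →
    (adj G (Bijection.to π i) (Bijection.to π j) ≡ true) ⇔ ((+ ∣ S i - S j ∣) ∈S S)

IsAutograph : {n : ℕ} → Graph n → Set
IsAutograph {n} G = ∃[ m ] Σ (Fin m → ℤ) λ S → Σ (Fin m ⤖ Fin n) λ π → IsSignature G S π

-- M6: complement is P3 ⊎ P3 with paths 0-1-2 and 3-4-5;
-- so the non-edges are exactly {0,1},{1,2},{3,4},{4,5} (11 edges).
M6-adj : Fin 6 → Fin 6 → Bool
M6-adj zero zero = false
M6-adj zero (suc zero) = false
M6-adj zero (suc (suc zero)) = true
M6-adj zero (suc (suc (suc zero))) = true
M6-adj zero (suc (suc (suc (suc zero)))) = true
M6-adj zero (suc (suc (suc (suc (suc zero))))) = true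
M6-adj (suc zero) zero = false
M6-adj (suc zero) (suc zero) = false
M6-adj (suc zero) (suc (suc zero)) = false
M6-adj (suc zero) (suc (suc (suc zero))) = true
M6-adj (suc zero) (suc (suc (suc (suc zero)))) = true
M6-adj (suc zero) (suc (suc (suc (suc (suc zero))))) = true
M6-adj (suc (suc zero)) zero = true
M6-adj (suc (suc zero)) (suc zero) = false
M6-adj (suc (suc zero)) (suc (suc zero)) = false
M6-adj (suc (suc zero)) (suc (suc (suc zero))) = true
M6-adj (suc (suc zero)) (suc (suc (suc (suc zero)))) = true
M6-adj (suc (suc zero)) (suc (suc (suc (suc (suc zero))))) = true
M6-adj (suc (suc (suc zero))) zero = true
M6-adj (suc (suc (suc zero))) (suc zero) = true
M6-adj (suc (suc (suc zero))) (suc (suc zero)) = true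
M6-adj (suc (suc (suc zero))) (suc (suc (suc zero))) = false
M6-adj (suc (suc (suc zero))) (suc (suc (suc (suc zero)))) = false
M6-adj (suc (suc (suc zero))) (suc (suc (suc (suc (suc zero))))) = true
M6-adj (suc (suc (suc (suc zero)))) zero = true
M6-adj (suc (suc (suc (suc zero)))) (suc zero) = true
M6-adj (suc (suc (suc (suc zero)))) (suc (suc zero)) = true
M6-adj (suc (suc (suc (suc zero)))) (suc (suc (suc zero))) = false
M6-adj (suc (suc (suc (suc zero)))) (suc (suc (suc (suc zero)))) = false
M6-adj (suc (suc (suc (suc zero)))) (suc (suc (suc (suc (suc zero))))) = false
M6-adj (suc (suc (suc (suc (suc zero))))) zero = true
M6-adj (suc (suc (suc (suc (suc zero))))) (suc zero) = true
M6-adj (suc (suc (suc (suc (suc zero))))) (suc (suc zero)) = true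
M6-adj (suc (suc (suc (suc (suc zero))))) (suc (suc (suc zero))) = true
M6-adj (suc (suc (suc (suc (suc zero))))) (suc (suc (suc (suc zero)))) = false
M6-adj (suc (suc (suc (suc (suc zero))))) (suc (suc (suc (suc (suc zero))))) = false

M6-sym : ∀ i j → M6-adj i j ≡ M6-adj j i
M6-sym zero zero = refl
M6-sym zero (suc zero) = refl
M6-sym zero (suc (suc zero)) = refl
M6-sym zero (suc (suc (suc zero))) = refl
M6-sym zero (suc (suc (suc (suc zero)))) = refl
M6-sym zero (suc (suc (suc (suc (suc zero))))) = refl
M6-sym (suc zero) zero = refl
M6-sym (suc zero) (suc zero) = refl
M6-sym (suc zero) (suc (suc zero)) = refl
M6-sym (suc zero) (suc (suc (suc zero))) = refl
M6-sym (suc zero) (suc (suc (suc (suc zero)))) = refl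
M6-sym (suc zero) (suc (suc (suc (suc (suc zero))))) = refl
M6-sym (suc (suc zero)) zero = refl
M6-sym (suc (suc zero)) (suc zero) = refl
M6-sym (suc (suc zero)) (suc (suc zero)) = refl
M6-sym (suc (suc zero)) (suc (suc (suc zero))) = refl
M6-sym (suc (suc zero)) (suc (suc (suc (suc zero)))) = refl
M6-sym (suc (suc zero)) (suc (suc (suc (suc (suc zero))))) = refl
M6-sym (suc (suc (suc zero))) zero = refl
M6-sym (suc (suc (suc zero))) (suc zero) = refl
M6-sym (suc (suc (suc zero))) (suc (suc zero)) = refl
M6-sym (suc (suc (suc zero))) (suc (suc (suc zero))) = refl
M6-sym (suc (suc (suc zero))) (suc (suc (suc (suc zero)))) = refl
M6-sym (suc (suc (suc zero))) (suc (suc (suc (suc (suc zero))))) = refl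
M6-sym (suc (suc (suc (suc zero)))) zero = refl
M6-sym (suc (suc (suc (suc zero)))) (suc zero) = refl
M6-sym (suc (suc (suc (suc zero)))) (suc (suc zero)) = refl
M6-sym (suc (suc (suc (suc zero)))) (suc (suc (suc zero))) = refl
M6-sym (suc (suc (suc (suc zero)))) (suc (suc (suc (suc zero)))) = refl
M6-sym (suc (suc (suc (suc zero)))) (suc (suc (suc (suc (suc zero))))) = refl
M6-sym (suc (suc (suc (suc (suc zero))))) zero = refl
M6-sym (suc (suc (suc (suc (suc zero))))) (suc zero) = refl
M6-sym (suc (suc (suc (suc (suc zero))))) (suc (suc zero)) = refl
M6-sym (suc (suc (suc (suc (suc zero))))) (suc (suc (suc zero))) = refl
M6-sym (suc (suc (suc (suc (suc zero))))) (suc (suc (suc (suc zero)))) = refl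
M6-sym (suc (suc (suc (suc (suc zero))))) (suc (suc (suc (suc (suc zero))))) = refl

M6-irrefl : ∀ i → M6-adj i i ≡ false
M6-irrefl zero = refl
M6-irrefl (suc zero) = refl
M6-irrefl (suc (suc zero)) = refl
M6-irrefl (suc (suc (suc zero))) = refl
M6-irrefl (suc (suc (suc (suc zero)))) = refl
M6-irrefl (suc (suc (suc (suc (suc zero))))) = refl

M6 : Graph 6
M6 = record { adj = M6-adj ; sym = M6-sym ; irrefl = M6-irrefl }

{-# OPTIONS --safe #-}
-- Relabelling the elements of a signature by vertices, G is an autograph iff
-- there is S : V → ℤ such that distinct i and j are adjacent iff ∣ S i − S j ∣
-- is a value of S.
--
-- Suppose S labels M6.  By the symmetries of M6 we may assume S 2 ≤ S 0,
-- S 5 ≤ S 3 and that the maximum of S is attained at 0 or 1.  An edge i j with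
-- S j ≤ S i gives a vertex k with S i − S j = S k ≥ 0, a non-edge excludes every
-- such k, and vertices with different neighbours elsewhere have different
-- values.  Branching on these alternatives leaves finitely many systems of
-- linear inequalities, each of which is refuted by Farkas multipliers.
--
-- For at most five vertices, each of the finitely many graphs is realised by a
-- permutation of one of the tabulated signatures.
module Submission where

open import Defs
open import Data.Bool using (Bool; true; false; not; _∧_; T; T?; if_then_else_)
import Data.Bool.Properties as 𝔹
open import Data.Fin as Fin using (Fin; zero; suc)
open import Data.Fin.Patterns
import Data.Fin.Properties as Fin
open import Data.Integer as ℤ using (ℤ; +_; _+_; _*_; -_; _-_; ∣_∣; _⊔_; 0ℤ; 1ℤ; -1ℤ)
import Data.Integer.Properties as ℤ
open import Data.Integer.Tactic.RingSolver using (solve-∀)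
open import Data.List using (List; []; _∷_; _++_; map; concatMap; filter; filterᵇ; cartesianProduct; allFin; null)
open import Data.List.Membership.Propositional using (_∈_)
open import Data.List.Membership.Propositional.Properties using (∈-filter⁺; ∈-filter⁻; ∈-cartesianProduct⁺; ∈-allFin)
open import Data.List.Relation.Unary.All as All using (All; []; _∷_)
import Data.List.Relation.Unary.All.Properties as All
open import Data.List.Relation.Unary.Any using (here)
open import Data.Nat as ℕ using (ℕ; zero; suc; _≤_; z≤n; s≤s)
open import Data.Product using (∃; ∃-syntax; _×_; _,_; proj₁; proj₂)
open import Data.Sum using (inj₁; inj₂)
open import Data.Unit using (tt)
open import Data.Vec as Vec using (Vec; []; _∷_; lookup; replicate; zipWith; _[_]≔_)
import Data.Vec.Properties as Vec
open import Function using (_∘_; id)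
open import Function.Bundles using (_⤖_; _⇔_; mk⇔; Bijection; Equivalence; Inverse)
open import Function.Construct.Identity using (⤖-id)
open import Function.Properties.Bijection using (⤖⇒↔)
open import Relation.Binary.Definitions using (tri<; tri≈; tri>)
open import Relation.Binary.PropositionalEquality as ≡ using (_≡_; _≢_; refl; cong; cong₂; subst; subst₂; trans)
open import Relation.Nullary using (¬_; Dec; yes; no; contradiction)
open import Relation.Nullary.Decidable using (⌊_⌋; toWitness; fromWitness; from-yes; _×-dec_; ¬?)

-- Signatures indexed by the vertices

Labels : {n : ℕ} → Graph n → (Fin n → ℤ) → Set
Labels {n} G S = IsSignature G S (⤖-id (Fin n))

-- As `f` is injective, distinct positions stay distinct; as it is surjective, `S` and `S ∘ f` have
-- the same values. Used with `f` the inverse of `π`, to index a signature by vertices, and with `f`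
-- an automorphism, to exploit the symmetries of `M6`.
reindex : ∀ {m n k} (G : Graph n) (G′ : Graph k) {S : Fin m → ℤ} {π : Fin m ⤖ Fin n} →
          IsSignature G S π →
          (f : Fin k → Fin m) (g : Fin m → Fin k) →
          (∀ i → g (f i) ≡ i) → (∀ i → f (g i) ≡ i) →
          (∀ i j → adj G (Bijection.to π (f i)) (Bijection.to π (f j)) ≡ adj G′ i j) →
          Labels G′ (S ∘ f)
reindex G G′ {S} {π} sig f g gf fg compat i j i≢j = mk⇔
  (λ a → back (Equivalence.to (sig (f i) (f j) fi≢fj) (trans (compat i j) a)))
  (λ { (k , p) → trans (≡.sym (compat i j)) (Equivalence.from (sig (f i) (f j) fi≢fj) (f k , p)) })
  where
  fi≢fj : f i ≢ f j
  fi≢fj e = i≢j (trans (≡.sym (gf i)) (trans (cong g e) (gf j)))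
  back : ∀ {x} → x ∈S S → x ∈S (S ∘ f)
  back (k , p) = g k , trans (cong S (fg k)) p

autograph⇒labels : ∀ {n} {G : Graph n} → IsAutograph G → ∃ (Labels G)
autograph⇒labels {G = G} (m , S , π , sig) =
  S ∘ from , reindex G G {π = π} sig from to strictlyInverseˡ strictlyInverseʳ
    (λ i j → cong₂ (adj G) (strictlyInverseˡ i) (strictlyInverseˡ j))
  where open Inverse (⤖⇒↔ π)

labels⇒autograph : ∀ {n} {G : Graph n} → ∃ (Labels G) → IsAutograph G
labels⇒autograph {n} (S , sig) = n , S , ⤖-id (Fin n) , sig

-- Refuting labellings of a graph by linear arithmetic

-- An affine form in the labels: the constant term first, then one coefficient per vertex.
Form : ℕ → Set
Form n = Vec ℤ (suc n)

dot : ∀ {n} → Vec ℤ n → (Fin n → ℤ) → ℤ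
dot []       S = 0ℤ
dot (a ∷ as) S = a * S zero + dot as (S ∘ suc)

⟦_⟧ : ∀ {n} → Form n → (Fin n → ℤ) → ℤ
⟦ c ∷ as ⟧ S = c + dot as S

const : ∀ {n} → ℤ → Form n
const c = c ∷ replicate _ 0ℤ

var : ∀ {n} → Fin n → Form n
var i = 0ℤ ∷ replicate _ 0ℤ [ i ]≔ 1ℤ

infixl 7 _⊕_ _⊖_
infix  6 _≽_ _≻_

-- Labels are integers, so f > g amounts to f - g - 1 ≥ 0. Strict and weak hypotheses alike thus
-- become the nonnegativity of one form; `_≽_` is `_⊖_` under a name that marks this reading.
_⊕_ _⊖_ _≽_ _≻_ : ∀ {n} → Form n → Form n → Form n
f ⊕ g = zipWith _+_ f g
f ⊖ g = f ⊕ Vec.map -_ g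
f ≽ g = f ⊖ g
f ≻ g = f ⊖ g ⊕ const -1ℤ

dot-0 : ∀ {n} (S : Fin n → ℤ) → dot (replicate n 0ℤ) S ≡ 0ℤ
dot-0 {zero}  S = refl
dot-0 {suc n} S = trans (ℤ.+-identityˡ _) (dot-0 (S ∘ suc))

dot-var : ∀ {n} i (S : Fin n → ℤ) → dot (replicate n 0ℤ [ i ]≔ 1ℤ) S ≡ S i
dot-var zero    S = trans (cong₂ _+_ (ℤ.*-identityˡ (S zero)) (dot-0 (S ∘ suc))) (ℤ.+-identityʳ (S zero))
dot-var (suc i) S = trans (ℤ.+-identityˡ _) (dot-var i (S ∘ suc))

dot-⊕ : ∀ {n} (as bs : Vec ℤ n) S → dot (zipWith _+_ as bs) S ≡ dot as S + dot bs S
dot-⊕ []       []       S = refl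
dot-⊕ (a ∷ as) (b ∷ bs) S =
  trans (cong (_+_ ((a + b) * S zero)) (dot-⊕ as bs (S ∘ suc))) (lemma a b (S zero) _ _)
  where
  lemma : ∀ a b s x y → (a + b) * s + (x + y) ≡ a * s + x + (b * s + y)
  lemma = solve-∀

dot-neg : ∀ {n} (as : Vec ℤ n) S → dot (Vec.map -_ as) S ≡ - dot as S
dot-neg []       S = refl
dot-neg (a ∷ as) S = trans (cong (_+_ (- a * S zero)) (dot-neg as (S ∘ suc))) (lemma a (S zero) _)
  where
  lemma : ∀ a s x → - a * s + - x ≡ - (a * s + x)
  lemma = solve-∀

⟦const⟧ : ∀ {n} c (S : Fin n → ℤ) → ⟦ const c ⟧ S ≡ c
⟦const⟧ c S = trans (cong (_+_ c) (dot-0 S)) (ℤ.+-identityʳ c)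

⟦var⟧ : ∀ {n} i (S : Fin n → ℤ) → ⟦ var i ⟧ S ≡ S i
⟦var⟧ i S = trans (ℤ.+-identityˡ _) (dot-var i S)

⟦⊕⟧ : ∀ {n} (f g : Form n) S → ⟦ f ⊕ g ⟧ S ≡ ⟦ f ⟧ S + ⟦ g ⟧ S
⟦⊕⟧ (c ∷ as) (d ∷ bs) S = trans (cong (_+_ (c + d)) (dot-⊕ as bs S)) (lemma c d _ _)
  where
  lemma : ∀ c d x y → c + d + (x + y) ≡ c + x + (d + y)
  lemma = solve-∀

⟦⊖⟧ : ∀ {n} (f g : Form n) S → ⟦ f ⊖ g ⟧ S ≡ ⟦ f ⟧ S - ⟦ g ⟧ S
⟦⊖⟧ f (d ∷ bs) S = trans (⟦⊕⟧ f (Vec.map -_ (d ∷ bs)) S)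
  (cong (_+_ (⟦ f ⟧ S)) (trans (cong (_+_ (- d)) (dot-neg bs S)) (≡.sym (ℤ.neg-distrib-+ d _))))

⟦var⊖var⟧ : ∀ {n} i j (S : Fin n → ℤ) → ⟦ var i ⊖ var j ⟧ S ≡ S i - S j
⟦var⊖var⟧ i j S = trans (⟦⊖⟧ (var i) (var j) S) (cong₂ _-_ (⟦var⟧ i S) (⟦var⟧ j S))

-- A form is read as the assertion that its value is nonnegative.
_⊨_ : ∀ {n} → (Fin n → ℤ) → List (Form n) → Set
S ⊨ Γ = All (λ f → 0ℤ ℤ.≤ ⟦ f ⟧ S) Γ

≽-intro : ∀ {n} (f g : Form n) {S x y} → ⟦ f ⟧ S ≡ x → ⟦ g ⟧ S ≡ y → y ℤ.≤ x → 0ℤ ℤ.≤ ⟦ f ≽ g ⟧ S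
≽-intro f g {S} refl refl y≤x = subst (0ℤ ℤ.≤_) (≡.sym (⟦⊖⟧ f g S)) (ℤ.i≤j⇒0≤j-i y≤x)

≻-intro : ∀ {n} (f g : Form n) {S x y} → ⟦ f ⟧ S ≡ x → ⟦ g ⟧ S ≡ y → y ℤ.< x → 0ℤ ℤ.≤ ⟦ f ≻ g ⟧ S
≻-intro f g {S} refl refl y<x = subst (0ℤ ℤ.≤_) (≡.sym eq) (ℤ.i≤j⇒0≤j-i (ℤ.i<j⇒suc[i]≤j y<x))
  where
  lemma : ∀ x y → x - y + -1ℤ ≡ x - (1ℤ + y)
  lemma = solve-∀
  eq : ⟦ f ≻ g ⟧ S ≡ ⟦ f ⟧ S - (1ℤ + ⟦ g ⟧ S)
  eq = trans (⟦⊕⟧ (f ⊖ g) (const -1ℤ) S)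
         (trans (cong₂ _+_ (⟦⊖⟧ f g S) (⟦const⟧ -1ℤ S)) (lemma (⟦ f ⟧ S) (⟦ g ⟧ S)))

-- Positions count from the most recently added hypothesis; a position out of
-- range stands for the form 0.
nth : ∀ {n} → List (Form n) → ℕ → Form n
nth []      k       = const 0ℤ
nth (f ∷ Γ) zero    = f
nth (f ∷ Γ) (suc k) = nth Γ k

total : ∀ {n} → List (Form n) → List ℕ → Form n
total Γ []       = const 0ℤ
total Γ (k ∷ ks) = nth Γ k ⊕ total Γ ks

-- All coefficients have to cancel, so that the value is the constant `c` whatever `S` is.
negative : ∀ {n} → Form n → Bool
negative (c ∷ as) = ⌊ (c ℤ.<? 0ℤ) ×-dec Vec.≡-dec ℤ._≟_ as (replicate _ 0ℤ) ⌋

nth-sound : ∀ {n} {S : Fin n → ℤ} {Γ} → S ⊨ Γ → ∀ k → 0ℤ ℤ.≤ ⟦ nth Γ k ⟧ S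
nth-sound {S = S} [] k   = ℤ.≤-reflexive (≡.sym (⟦const⟧ 0ℤ S))
nth-sound (h ∷ hs) zero    = h
nth-sound (h ∷ hs) (suc k) = nth-sound hs k

total-sound : ∀ {n} {S : Fin n → ℤ} {Γ} → S ⊨ Γ → ∀ ks → 0ℤ ℤ.≤ ⟦ total Γ ks ⟧ S
total-sound {S = S} hs []         = ℤ.≤-reflexive (≡.sym (⟦const⟧ 0ℤ S))
total-sound {S = S} {Γ} hs (k ∷ ks) = subst (0ℤ ℤ.≤_) (≡.sym (⟦⊕⟧ (nth Γ k) (total Γ ks) S))
  (ℤ.+-mono-≤ (nth-sound hs k) (total-sound hs ks))

negative-sound : ∀ {n} (f : Form n) S → T (negative f) → ⟦ f ⟧ S ℤ.< 0ℤ
negative-sound (c ∷ as) S neg with toWitness {a? = (c ℤ.<? 0ℤ) ×-dec Vec.≡-dec ℤ._≟_ as (replicate _ 0ℤ)} neg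
... | c<0 , refl = subst (ℤ._< 0ℤ) (≡.sym (⟦const⟧ c S)) c<0

absurd : ∀ {n} → List (Form n) → List ℕ → Bool
absurd Γ ks = negative (total Γ ks)

-- The easy direction of Farkas' lemma: hypotheses that hold at `S` have a sum that is nonnegative
-- at `S`.
absurd-sound : ∀ {n} {S : Fin n → ℤ} {Γ} ks → T (absurd Γ ks) → ¬ (S ⊨ Γ)
absurd-sound {S = S} {Γ} ks abs hs =
  ℤ.<⇒≱ (negative-sound (total Γ ks) S abs) (total-sound hs ks)

-- A refutation tree.  The lists of positions name hypotheses, repeated
-- according to their Farkas multipliers, that sum to a negative constant;
-- those of edge i j and nonedge i j k refute S i < S j.  In apart i j w, the
-- vertex w is adjacent to exactly one of i and j, which forces S i ≢ S j.
data Cert (n : ℕ) : Set where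
  leaf    : List ℕ → Cert n
  sign    : Fin n → Cert n → Cert n → Cert n
  apart   : Fin n → Fin n → Fin n → Cert n → Cert n → Cert n
  edge    : Fin n → Fin n → List ℕ → Vec (Cert n) n → Cert n
  nonedge : Fin n → Fin n → Fin n → List ℕ → Cert n → Cert n → Cert n

module _ {n} (G : Graph n) where

  separates? : ∀ i j w → Dec (i ≢ w × j ≢ w × adj G i w ≢ adj G j w)
  separates? i j w = ¬? (i Fin.≟ w) ×-dec ¬? (j Fin.≟ w) ×-dec ¬? (adj G i w 𝔹.≟ adj G j w)

  adjacent? : ∀ i j b → Dec (i ≢ j × adj G i j ≡ b)
  adjacent? i j b = ¬? (i Fin.≟ j) ×-dec adj G i j 𝔹.≟ b

  -- Since hypotheses are nonnegative forms, the equation between `S k` and `S i - S j` enters as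
  -- two opposite inequalities. The first form records that `S k` is an absolute value.
  gap : Fin n → Fin n → Fin n → List (Form n)
  gap i j k = (var k ≽ const 0ℤ) ∷ (var i ⊖ var j ≽ var k) ∷ (var k ≽ var i ⊖ var j) ∷ []

  -- New hypotheses go to the front: on passing to a child, old positions grow by 1, or by 3 below
  -- an `edge`, where `gap` adds three forms. The list `ks` of an `edge` or `nonedge` is checked
  -- with the assumption `var j ≻ var i` at position 0.
  refutes     : List (Form n) → Cert n → Bool
  -- `ι` tells which vertex each remaining certificate belongs to. Recursion along the vector, in
  -- place of a lookup for each vertex, keeps the mutual recursion structural.
  refutesGaps : ∀ {m} → List (Form n) → (i j : Fin n) → (Fin m → Fin n) → Vec (Cert n) m → Bool
  refutes Γ (leaf ks)              = absurd Γ ks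
  refutes Γ (sign k c d)           = refutes (var k ≽ const 0ℤ ∷ Γ) c ∧ refutes (const 0ℤ ≻ var k ∷ Γ) d
  refutes Γ (apart i j w c d)      = ⌊ separates? i j w ⌋ ∧
    refutes (var i ≻ var j ∷ Γ) c ∧ refutes (var j ≻ var i ∷ Γ) d
  refutes Γ (edge i j ks cs)       = ⌊ adjacent? i j true ⌋ ∧ absurd (var j ≻ var i ∷ Γ) ks ∧
    refutesGaps Γ i j id cs
  refutes Γ (nonedge i j k ks c d) = ⌊ adjacent? i j false ⌋ ∧ absurd (var j ≻ var i ∷ Γ) ks ∧
    refutes (var k ≻ var i ⊖ var j ∷ Γ) c ∧ refutes (var i ⊖ var j ≻ var k ∷ Γ) d
  refutesGaps Γ i j ι []       = true
  refutesGaps Γ i j ι (c ∷ cs) = refutes (gap i j (ι zero) ++ Γ) c ∧ refutesGaps Γ i j (ι ∘ suc) cs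

  module _ {S : Fin n → ℤ} (labels : Labels G S) where

    -- Equal labels have the same absolute difference from `S w`, hence the same adjacency to `w`.
    -- The signature condition speaks of distinct elements only, so `w` has to differ from both.
    separated : ∀ i j w → i ≢ w × j ≢ w × adj G i w ≢ adj G j w → S i ≢ S j
    separated i j w (i≢w , j≢w , differ) Si≡Sj =
      differ (𝔹.⇔→≡ (mk⇔ (carry i≢w j≢w Si≡Sj) (carry j≢w i≢w (≡.sym Si≡Sj))))
      where
      carry : ∀ {i j} → i ≢ w → j ≢ w → S i ≡ S j → adj G i w ≡ true → adj G j w ≡ true
      carry i≢w j≢w Si≡Sj a = Equivalence.from (labels _ w j≢w)
        (subst (λ s → (+ ∣ s - S w ∣) ∈S S) Si≡Sj (Equivalence.to (labels _ w i≢w) a))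

    ordered : ∀ {Γ} i j ks → S ⊨ Γ → T (absurd (var j ≻ var i ∷ Γ) ks) → + ∣ S i - S j ∣ ≡ S i - S j
    ordered i j ks hs abs = ℤ.0≤i⇒+∣i∣≡i (ℤ.i≤j⇒0≤j-i (ℤ.≮⇒≥ λ Si<Sj →
      absurd-sound ks abs (≻-intro (var j) (var i) (⟦var⟧ j S) (⟦var⟧ i S) Si<Sj ∷ hs)))

    refutes-sound : ∀ {Γ} c → T (refutes Γ c) → ¬ (S ⊨ Γ)
    -- An edge supplies some vertex `k` whose label is the difference; peeling `k` and the vector
    -- together leads to the certificate prepared for it.
    refutesGaps-sound : ∀ {Γ m} i j (ι : Fin m → Fin n) cs → T (refutesGaps Γ i j ι cs) → S ⊨ Γ →
                        0ℤ ℤ.≤ S i - S j → ∀ k → S (ι k) ≢ S i - S j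
    refutes-sound (leaf ks) ok hs = absurd-sound ks ok hs
    refutes-sound (sign k c d) ok hs with Equivalence.to 𝔹.T-∧ ok | 0ℤ ℤ.≤? S k
    ... | okc , _ | yes 0≤Sk =
      refutes-sound c okc (≽-intro (var k) (const 0ℤ) (⟦var⟧ k S) (⟦const⟧ 0ℤ S) 0≤Sk ∷ hs)
    ... | _ , okd | no  0≰Sk =
      refutes-sound d okd (≻-intro (const 0ℤ) (var k) (⟦const⟧ 0ℤ S) (⟦var⟧ k S) (ℤ.≰⇒> 0≰Sk) ∷ hs)
    refutes-sound (apart i j w c d) ok hs with Equivalence.to 𝔹.T-∧ ok
    ... | sep , ok′ with Equivalence.to 𝔹.T-∧ ok′ | ℤ.<-cmp (S i) (S j)
    ...   | okc , okd | tri< Si<Sj _ _ =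
      refutes-sound d okd (≻-intro (var j) (var i) (⟦var⟧ j S) (⟦var⟧ i S) Si<Sj ∷ hs)
    ...   | okc , okd | tri≈ _ Si≡Sj _ = separated i j w (toWitness {a? = separates? i j w} sep) Si≡Sj
    ...   | okc , okd | tri> _ _ Sj<Si =
      refutes-sound c okc (≻-intro (var i) (var j) (⟦var⟧ i S) (⟦var⟧ j S) Sj<Si ∷ hs)
    refutes-sound (edge i j ks cs) ok hs with Equivalence.to 𝔹.T-∧ ok
    ... | ij , ok′ with Equivalence.to 𝔹.T-∧ ok′ | toWitness {a? = adjacent? i j true} ij
    ...   | abs , okcs | i≢j , adj-ij with Equivalence.to (labels i j i≢j) adj-ij
    ...     | k , Sk≡ = refutesGaps-sound i j id cs okcs hs (subst (0ℤ ℤ.≤_) gap≡ (ℤ.+≤+ z≤n)) k (trans Sk≡ gap≡)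
      where gap≡ = ordered i j ks hs abs
    refutes-sound (nonedge i j k ks c d) ok hs with Equivalence.to 𝔹.T-∧ ok
    ... | ij , ok′ with Equivalence.to 𝔹.T-∧ ok′ | toWitness {a? = adjacent? i j false} ij
    ...   | abs , ok″ | i≢j , ¬adj-ij with Equivalence.to 𝔹.T-∧ ok″ | ℤ.<-cmp (S k) (S i - S j)
    ...     | okc , okd | tri< lt _ _ =
      refutes-sound d okd (≻-intro (var i ⊖ var j) (var k) (⟦var⊖var⟧ i j S) (⟦var⟧ k S) lt ∷ hs)
    -- Equality would make the difference a value of `S` and so turn the non-edge into an edge.
    ...     | okc , okd | tri≈ _ eq _ = contradiction
      (trans (≡.sym ¬adj-ij) (Equivalence.from (labels i j i≢j) (k , trans eq (≡.sym (ordered i j ks hs abs)))))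
      λ ()
    ...     | okc , okd | tri> _ _ gt =
      refutes-sound c okc (≻-intro (var k) (var i ⊖ var j) (⟦var⟧ k S) (⟦var⊖var⟧ i j S) gt ∷ hs)
    refutesGaps-sound i j ι (c ∷ cs) ok hs 0≤ (suc k) Sk≡ =
      refutesGaps-sound i j (ι ∘ suc) cs (proj₂ (Equivalence.to 𝔹.T-∧ ok)) hs 0≤ k Sk≡
    refutesGaps-sound i j ι (c ∷ cs) ok hs 0≤ zero Sk≡ = refutes-sound c (proj₁ (Equivalence.to 𝔹.T-∧ ok))
      ( ≽-intro (var (ι zero)) (const 0ℤ) (⟦var⟧ _ S) (⟦const⟧ 0ℤ S) (subst (0ℤ ℤ.≤_) (≡.sym Sk≡) 0≤)
      ∷ ≽-intro (var i ⊖ var j) (var (ι zero)) (⟦var⊖var⟧ i j S) (⟦var⟧ _ S) (ℤ.≤-reflexive Sk≡)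
      ∷ ≽-intro (var (ι zero)) (var i ⊖ var j) (⟦var⟧ _ S) (⟦var⊖var⟧ i j S) (ℤ.≤-reflexive (≡.sym Sk≡))
      ∷ hs)

-- Refutation certificates for `M6`

-- The root hypotheses are those of `order₀`. The vector of an `edge i j` lists the cases
-- `S i - S j` = `S k` in the order of `k`. Two refutations recur: the equation also reads
-- `S i - S k` = `S j`, against a non-edge i k; or two equations force equal labels, against an
-- `apart`.
max-at-0 : Cert 6
max-at-0 =
 -- Three splits make `S 0` strictly larger than `S 4`, `S 1` and `S 3`. The opposite branches,
 -- closed by the last three leaves, contradict maximality directly.
 (apart 0F 4F 1F
  (apart 0F 1F 2F
   (apart 0F 3F 1F
    (edge 0F 3F (0 ∷ 1 ∷ []) (
     -- Here `S 3` = 0. If `S 4` is negative, the edge 0 4 needs the label `S 0 - S 4`, above the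
     -- maximum; if it is positive, `S 4 - S 3` = `S 4` contradicts the non-edge 3 4.
     (apart 3F 4F 5F
      (nonedge 3F 4F 4F (0 ∷ 1 ∷ [])
       (leaf (0 ∷ 1 ∷ 1 ∷ 3 ∷ []))
       (edge 0F 4F (0 ∷ 0 ∷ 1 ∷ 3 ∷ 3 ∷ 4 ∷ []) (
        (leaf (2 ∷ 2 ∷ 3 ∷ 6 ∷ [])) ∷
        (leaf (2 ∷ 2 ∷ 3 ∷ 6 ∷ 9 ∷ 9 ∷ [])) ∷
        (leaf (2 ∷ 2 ∷ 3 ∷ 6 ∷ 11 ∷ 11 ∷ [])) ∷
        (leaf (2 ∷ 2 ∷ 3 ∷ 5 ∷ 5 ∷ 6 ∷ 6 ∷ 6 ∷ [])) ∷
        (leaf (0 ∷ 0 ∷ 3 ∷ 6 ∷ [])) ∷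
        (leaf (2 ∷ 2 ∷ 3 ∷ 5 ∷ 5 ∷ 6 ∷ 6 ∷ 6 ∷ 12 ∷ 12 ∷ [])) ∷ [])))
      (nonedge 4F 3F 4F (0 ∷ 1 ∷ [])
       (leaf (0 ∷ 3 ∷ []))
       (leaf (0 ∷ 4 ∷ [])))) ∷
     (nonedge 0F 1F 3F (0 ∷ 5 ∷ [])
      (leaf (0 ∷ 2 ∷ []))
      (leaf (0 ∷ 3 ∷ []))) ∷
     -- In the four remaining children `S 0` is S 2 + S 3, 2 S 3, S 3 + S 4 and S 3 + S 5 in turn.
     -- Each proceeds with a second edge at 0, to 4 or 5, and combines the two equations.
     (edge 0F 4F (0 ∷ 6 ∷ []) (
      (nonedge 3F 4F 3F (0 ∷ 2 ∷ 6 ∷ 10 ∷ [])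
       (leaf (0 ∷ 2 ∷ []))
       (leaf (0 ∷ 3 ∷ []))) ∷
      (nonedge 0F 1F 4F (0 ∷ 8 ∷ [])
       (leaf (0 ∷ 2 ∷ []))
       (leaf (0 ∷ 3 ∷ []))) ∷
      (apart 3F 4F 5F
       (leaf (0 ∷ 3 ∷ 5 ∷ []))
       (leaf (0 ∷ 2 ∷ 6 ∷ []))) ∷
      (apart 2F 4F 1F
       (leaf (0 ∷ 3 ∷ 5 ∷ []))
       (leaf (0 ∷ 2 ∷ 6 ∷ []))) ∷
      (edge 0F 5F (0 ∷ 4 ∷ 5 ∷ 11 ∷ []) (
       (nonedge 4F 5F 4F (0 ∷ 2 ∷ 4 ∷ [])
        (leaf (0 ∷ 2 ∷ []))
        (leaf (0 ∷ 3 ∷ []))) ∷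
       (nonedge 0F 1F 5F (0 ∷ 11 ∷ [])
        (leaf (0 ∷ 2 ∷ []))
        (leaf (0 ∷ 3 ∷ []))) ∷
       (edge 3F 5F (0 ∷ 2 ∷ 9 ∷ []) (
        (leaf (1 ∷ 5 ∷ 6 ∷ 10 ∷ 14 ∷ [])) ∷
        (nonedge 0F 1F 0F (0 ∷ 2 ∷ 6 ∷ 7 ∷ 7 ∷ 8 ∷ 11 ∷ [])
         (leaf (0 ∷ 2 ∷ 6 ∷ 11 ∷ []))
         (leaf (0 ∷ 1 ∷ []))) ∷
        (leaf (1 ∷ 5 ∷ 12 ∷ [])) ∷
        (nonedge 4F 3F 4F (0 ∷ 2 ∷ 6 ∷ 7 ∷ 11 ∷ [])
         (leaf (0 ∷ 2 ∷ 6 ∷ 11 ∷ []))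
         (leaf (0 ∷ 1 ∷ []))) ∷
        (leaf (1 ∷ 5 ∷ 8 ∷ 10 ∷ 14 ∷ [])) ∷
        (nonedge 4F 5F 4F (0 ∷ 2 ∷ 6 ∷ 7 ∷ 11 ∷ [])
         (leaf (0 ∷ 2 ∷ 6 ∷ 11 ∷ []))
         (leaf (0 ∷ 1 ∷ []))) ∷ [])) ∷
       (apart 2F 5F 1F
        (leaf (0 ∷ 3 ∷ 8 ∷ []))
        (leaf (0 ∷ 2 ∷ 9 ∷ []))) ∷
       (apart 4F 5F 3F
        (leaf (0 ∷ 3 ∷ 5 ∷ []))
        (leaf (0 ∷ 2 ∷ 6 ∷ []))) ∷
       (apart 4F 5F 3F
        (leaf (0 ∷ 0 ∷ 3 ∷ 5 ∷ []))
        (leaf (0 ∷ 0 ∷ 2 ∷ 6 ∷ []))) ∷ [])) ∷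
      (apart 2F 4F 1F
       (leaf (0 ∷ 3 ∷ 5 ∷ 11 ∷ []))
       (edge 4F 2F (0 ∷ 1 ∷ []) (
        (leaf (1 ∷ 4 ∷ 5 ∷ 9 ∷ 10 ∷ [])) ∷
        (apart 1F 5F 0F
         (edge 1F 5F (0 ∷ 1 ∷ []) (
          (leaf (1 ∷ 5 ∷ 8 ∷ 8 ∷ 9 ∷ 13 ∷ 14 ∷ [])) ∷
          (leaf (1 ∷ 10 ∷ 16 ∷ [])) ∷
          (nonedge 1F 2F 5F (0 ∷ 2 ∷ 9 ∷ [])
           (leaf (0 ∷ 2 ∷ []))
           (leaf (0 ∷ 3 ∷ []))) ∷
          (leaf (1 ∷ 5 ∷ 8 ∷ 13 ∷ 16 ∷ [])) ∷
          (leaf (1 ∷ 5 ∷ 8 ∷ 13 ∷ 14 ∷ [])) ∷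
          (apart 2F 5F 1F
           (edge 2F 5F (0 ∷ 1 ∷ []) (
            (leaf (1 ∷ 4 ∷ 4 ∷ 4 ∷ 7 ∷ 9 ∷ 13 ∷ [])) ∷
            (apart 2F 3F 1F
             (leaf (0 ∷ 3 ∷ 10 ∷ 14 ∷ 18 ∷ []))
             (leaf (0 ∷ 2 ∷ 11 ∷ 15 ∷ 17 ∷ []))) ∷
            (leaf (1 ∷ 6 ∷ 7 ∷ [])) ∷
            (nonedge 4F 3F 3F (0 ∷ 2 ∷ 5 ∷ 5 ∷ 5 ∷ 6 ∷ 10 ∷ [])
             (leaf (0 ∷ 2 ∷ 15 ∷ 17 ∷ []))
             (leaf (0 ∷ 3 ∷ 14 ∷ 18 ∷ []))) ∷
            (leaf (1 ∷ 4 ∷ 4 ∷ 7 ∷ 9 ∷ [])) ∷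
            (apart 1F 2F 0F
             (leaf (0 ∷ 2 ∷ 7 ∷ []))
             (leaf (0 ∷ 3 ∷ 6 ∷ []))) ∷ []))
           (edge 5F 2F (0 ∷ 1 ∷ []) (
            (leaf (1 ∷ 3 ∷ 3 ∷ 5 ∷ 9 ∷ 13 ∷ 15 ∷ 15 ∷ 15 ∷ 15 ∷ [])) ∷
            (leaf (1 ∷ 3 ∷ 5 ∷ 15 ∷ 15 ∷ [])) ∷
            (nonedge 3F 4F 2F (0 ∷ 1 ∷ 2 ∷ 14 ∷ 18 ∷ [])
             (leaf (0 ∷ 2 ∷ 14 ∷ 18 ∷ []))
             (leaf (0 ∷ 3 ∷ 15 ∷ 17 ∷ []))) ∷
            (leaf (1 ∷ 3 ∷ 3 ∷ 5 ∷ 9 ∷ 13 ∷ 15 ∷ 15 ∷ 15 ∷ 17 ∷ [])) ∷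
            (leaf (1 ∷ 3 ∷ 5 ∷ 9 ∷ 15 ∷ 15 ∷ 15 ∷ [])) ∷
            (leaf (1 ∷ 17 ∷ 18 ∷ [])) ∷ []))) ∷ []))
         (edge 5F 1F (0 ∷ 1 ∷ []) (
          (leaf (1 ∷ 4 ∷ 7 ∷ 9 ∷ 11 ∷ [])) ∷
          (apart 2F 5F 1F
           (edge 2F 5F (0 ∷ 1 ∷ []) (
            (leaf (1 ∷ 4 ∷ 4 ∷ 4 ∷ 7 ∷ 7 ∷ 9 ∷ 13 ∷ [])) ∷
            (apart 2F 3F 1F
             (leaf (0 ∷ 3 ∷ 10 ∷ 14 ∷ 18 ∷ []))
             (leaf (0 ∷ 2 ∷ 11 ∷ 15 ∷ 17 ∷ []))) ∷
            (leaf (1 ∷ 4 ∷ 7 ∷ [])) ∷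
            (nonedge 4F 3F 3F (0 ∷ 2 ∷ 5 ∷ 5 ∷ 5 ∷ 6 ∷ 10 ∷ [])
             (leaf (0 ∷ 2 ∷ 15 ∷ 17 ∷ []))
             (leaf (0 ∷ 3 ∷ 14 ∷ 18 ∷ []))) ∷
            (leaf (1 ∷ 4 ∷ 4 ∷ 7 ∷ 9 ∷ [])) ∷
            (nonedge 4F 3F 5F (0 ∷ 1 ∷ 2 ∷ 15 ∷ 17 ∷ [])
             (leaf (0 ∷ 2 ∷ 15 ∷ 17 ∷ []))
             (leaf (0 ∷ 3 ∷ 14 ∷ 18 ∷ []))) ∷ []))
           (edge 5F 2F (0 ∷ 1 ∷ []) (
            (leaf (1 ∷ 1 ∷ 3 ∷ 6 ∷ 9 ∷ 9 ∷ 13 ∷ 13 ∷ 15 ∷ 15 ∷ 15 ∷ 15 ∷ 15 ∷ [])) ∷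
            (apart 4F 5F 3F
             (leaf (0 ∷ 2 ∷ 11 ∷ []))
             (leaf (0 ∷ 3 ∷ 10 ∷ []))) ∷
            (apart 1F 2F 0F
             (leaf (0 ∷ 0 ∷ 3 ∷ 6 ∷ []))
             (leaf (0 ∷ 0 ∷ 2 ∷ 7 ∷ []))) ∷
            (leaf (1 ∷ 1 ∷ 3 ∷ 6 ∷ 9 ∷ 9 ∷ 13 ∷ 13 ∷ 15 ∷ 15 ∷ 15 ∷ 17 ∷ 17 ∷ [])) ∷
            (nonedge 1F 2F 2F (0 ∷ 0 ∷ 0 ∷ 1 ∷ 2 ∷ 2 ∷ 7 ∷ 7 ∷ 10 ∷ [])
             (leaf (0 ∷ 2 ∷ 7 ∷ 10 ∷ []))
             (leaf (0 ∷ 3 ∷ 6 ∷ 11 ∷ []))) ∷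
            (leaf (1 ∷ 17 ∷ 18 ∷ [])) ∷ []))) ∷
          (apart 4F 5F 3F
           (leaf (0 ∷ 2 ∷ 7 ∷ []))
           (leaf (0 ∷ 3 ∷ 6 ∷ []))) ∷
          (leaf (1 ∷ 4 ∷ 7 ∷ 9 ∷ 13 ∷ [])) ∷
          (nonedge 5F 4F 1F (0 ∷ 2 ∷ 5 ∷ [])
           (leaf (0 ∷ 2 ∷ []))
           (leaf (0 ∷ 3 ∷ []))) ∷
          (leaf (1 ∷ 6 ∷ 7 ∷ [])) ∷ []))) ∷
        (apart 2F 5F 1F
         (edge 2F 5F (0 ∷ 1 ∷ []) (
          (leaf (1 ∷ 3 ∷ 5 ∷ 8 ∷ 8 ∷ 8 ∷ 9 ∷ [])) ∷
          (nonedge 2F 1F 5F (0 ∷ 2 ∷ 9 ∷ [])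
           (leaf (0 ∷ 2 ∷ []))
           (leaf (0 ∷ 3 ∷ []))) ∷
          (leaf (1 ∷ 10 ∷ 16 ∷ [])) ∷
          (leaf (1 ∷ 5 ∷ 8 ∷ 13 ∷ 16 ∷ [])) ∷
          (leaf (1 ∷ 3 ∷ 5 ∷ 8 ∷ 8 ∷ [])) ∷
          (nonedge 4F 5F 3F (0 ∷ 1 ∷ 1 ∷ 1 ∷ 2 ∷ 2 ∷ 6 ∷ [])
           (leaf (0 ∷ 2 ∷ 11 ∷ 13 ∷ []))
           (leaf (0 ∷ 3 ∷ 10 ∷ 14 ∷ []))) ∷ []))
         (edge 5F 2F (0 ∷ 1 ∷ []) (
          (leaf (1 ∷ 4 ∷ 4 ∷ 7 ∷ 9 ∷ [])) ∷
          (nonedge 3F 4F 1F (0 ∷ 1 ∷ 2 ∷ 10 ∷ 14 ∷ [])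
           (leaf (0 ∷ 2 ∷ 10 ∷ 14 ∷ []))
           (leaf (0 ∷ 3 ∷ 11 ∷ 13 ∷ []))) ∷
          (apart 4F 5F 3F
           (leaf (0 ∷ 2 ∷ 7 ∷ []))
           (leaf (0 ∷ 3 ∷ 6 ∷ []))) ∷
          (leaf (1 ∷ 4 ∷ 7 ∷ 9 ∷ 13 ∷ [])) ∷
          (nonedge 5F 4F 2F (0 ∷ 2 ∷ 5 ∷ [])
           (leaf (0 ∷ 2 ∷ []))
           (leaf (0 ∷ 3 ∷ []))) ∷
          (leaf (1 ∷ 6 ∷ 7 ∷ [])) ∷ []))) ∷
        (leaf (1 ∷ 9 ∷ 12 ∷ [])) ∷
        (leaf (1 ∷ 9 ∷ 10 ∷ [])) ∷
        (nonedge 4F 5F 2F (0 ∷ 2 ∷ 8 ∷ [])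
         (leaf (0 ∷ 2 ∷ []))
         (leaf (0 ∷ 3 ∷ []))) ∷ []))) ∷ [])) ∷
     (edge 0F 4F (0 ∷ 6 ∷ []) (
      (nonedge 3F 4F 3F (0 ∷ 2 ∷ 4 ∷ [])
       (leaf (0 ∷ 2 ∷ []))
       (leaf (0 ∷ 3 ∷ []))) ∷
      (nonedge 0F 1F 4F (0 ∷ 8 ∷ [])
       (leaf (0 ∷ 2 ∷ []))
       (leaf (0 ∷ 3 ∷ []))) ∷
      (edge 0F 5F (0 ∷ 4 ∷ 5 ∷ 11 ∷ []) (
       (nonedge 4F 5F 4F (0 ∷ 2 ∷ 6 ∷ 13 ∷ [])
        (leaf (0 ∷ 2 ∷ []))
        (leaf (0 ∷ 3 ∷ []))) ∷
       (nonedge 0F 1F 5F (0 ∷ 11 ∷ [])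
        (leaf (0 ∷ 2 ∷ []))
        (leaf (0 ∷ 3 ∷ []))) ∷
       (apart 4F 5F 3F
        (leaf (0 ∷ 3 ∷ 5 ∷ []))
        (leaf (0 ∷ 2 ∷ 6 ∷ []))) ∷
       (edge 3F 5F (0 ∷ 2 ∷ 9 ∷ []) (
        (leaf (1 ∷ 5 ∷ 12 ∷ 12 ∷ [])) ∷
        (nonedge 2F 1F 2F (0 ∷ 2 ∷ 6 ∷ 7 ∷ 11 ∷ [])
         (leaf (0 ∷ 2 ∷ 6 ∷ 11 ∷ []))
         (leaf (0 ∷ 1 ∷ []))) ∷
        (leaf (1 ∷ 5 ∷ 8 ∷ 10 ∷ 14 ∷ [])) ∷
        (leaf (1 ∷ 5 ∷ 12 ∷ [])) ∷
        (nonedge 5F 4F 5F (0 ∷ 2 ∷ 4 ∷ 6 ∷ 6 ∷ 11 ∷ 11 ∷ [])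
         (leaf (0 ∷ 2 ∷ 6 ∷ 11 ∷ []))
         (leaf (0 ∷ 1 ∷ []))) ∷
        (leaf (1 ∷ 5 ∷ 5 ∷ 10 ∷ 12 ∷ [])) ∷ [])) ∷
       (apart 2F 5F 1F
        (leaf (0 ∷ 3 ∷ 5 ∷ []))
        (leaf (0 ∷ 2 ∷ 6 ∷ []))) ∷
       (edge 3F 5F (0 ∷ 0 ∷ 2 ∷ 9 ∷ []) (
        (leaf (1 ∷ 3 ∷ 12 ∷ [])) ∷
        (nonedge 2F 1F 2F (0 ∷ 0 ∷ 2 ∷ 2 ∷ 6 ∷ 7 ∷ 7 ∷ 11 ∷ [])
         (leaf (0 ∷ 0 ∷ 2 ∷ 2 ∷ 6 ∷ 11 ∷ []))
         (leaf (0 ∷ 1 ∷ []))) ∷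
        (leaf (1 ∷ 1 ∷ 5 ∷ 8 ∷ 8 ∷ 10 ∷ 14 ∷ 14 ∷ [])) ∷
        (leaf (0 ∷ 1 ∷ 1 ∷ 5 ∷ 12 ∷ [])) ∷
        (nonedge 3F 4F 5F (0 ∷ 2 ∷ 4 ∷ [])
         (leaf (0 ∷ 2 ∷ []))
         (leaf (0 ∷ 3 ∷ []))) ∷
        (leaf (1 ∷ 5 ∷ 12 ∷ [])) ∷ [])) ∷ [])) ∷
      (apart 3F 4F 5F
       (leaf (0 ∷ 3 ∷ 5 ∷ []))
       (leaf (0 ∷ 2 ∷ 6 ∷ []))) ∷
      (apart 3F 4F 5F
       (leaf (0 ∷ 0 ∷ 3 ∷ 5 ∷ []))
       (leaf (0 ∷ 0 ∷ 2 ∷ 6 ∷ []))) ∷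
      (apart 3F 4F 5F
       (leaf (0 ∷ 3 ∷ 5 ∷ 11 ∷ []))
       (edge 3F 5F (0 ∷ 1 ∷ 3 ∷ 7 ∷ []) (
        (leaf (1 ∷ 3 ∷ 4 ∷ 4 ∷ 5 ∷ [])) ∷
        (nonedge 4F 3F 1F (0 ∷ 4 ∷ [])
         (leaf (0 ∷ 2 ∷ 7 ∷ 9 ∷ []))
         (leaf (0 ∷ 3 ∷ 6 ∷ 10 ∷ []))) ∷
        (nonedge 4F 3F 2F (0 ∷ 4 ∷ [])
         (leaf (0 ∷ 2 ∷ 7 ∷ 9 ∷ []))
         (leaf (0 ∷ 3 ∷ 6 ∷ 10 ∷ []))) ∷
        (leaf (1 ∷ 6 ∷ 12 ∷ [])) ∷
        (leaf (1 ∷ 3 ∷ 4 ∷ [])) ∷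
        (nonedge 4F 3F 5F (0 ∷ 4 ∷ [])
         (leaf (0 ∷ 2 ∷ 7 ∷ 9 ∷ []))
         (leaf (0 ∷ 3 ∷ 6 ∷ 10 ∷ []))) ∷ []))) ∷ [])) ∷
     (edge 0F 5F (0 ∷ 1 ∷ 2 ∷ 8 ∷ []) (
      (nonedge 4F 5F 4F (0 ∷ 2 ∷ 4 ∷ [])
       (leaf (0 ∷ 2 ∷ []))
       (leaf (0 ∷ 3 ∷ []))) ∷
      (nonedge 0F 1F 5F (0 ∷ 8 ∷ [])
       (leaf (0 ∷ 2 ∷ []))
       (leaf (0 ∷ 3 ∷ []))) ∷
      (apart 2F 4F 1F
       (edge 2F 4F (0 ∷ 1 ∷ []) (
        (leaf (1 ∷ 9 ∷ 10 ∷ 13 ∷ [])) ∷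
        (nonedge 2F 1F 4F (0 ∷ 2 ∷ 8 ∷ [])
         (leaf (0 ∷ 2 ∷ []))
         (leaf (0 ∷ 3 ∷ []))) ∷
        (leaf (1 ∷ 9 ∷ 10 ∷ [])) ∷
        (nonedge 4F 5F 4F (0 ∷ 2 ∷ 6 ∷ 8 ∷ 10 ∷ [])
         (leaf (0 ∷ 2 ∷ 6 ∷ 10 ∷ []))
         (leaf (0 ∷ 3 ∷ 7 ∷ 9 ∷ []))) ∷
        (nonedge 3F 4F 5F (0 ∷ 2 ∷ 10 ∷ 14 ∷ [])
         (leaf (0 ∷ 2 ∷ 6 ∷ 10 ∷ []))
         (leaf (0 ∷ 3 ∷ 7 ∷ 9 ∷ []))) ∷
        (apart 2F 3F 1F
         (edge 2F 3F (0 ∷ 1 ∷ []) (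
          (leaf (1 ∷ 4 ∷ 4 ∷ 7 ∷ 9 ∷ 9 ∷ 13 ∷ [])) ∷
          (nonedge 2F 1F 3F (0 ∷ 2 ∷ 5 ∷ 5 ∷ 6 ∷ 10 ∷ 14 ∷ [])
           (leaf (0 ∷ 2 ∷ []))
           (leaf (0 ∷ 3 ∷ []))) ∷
          (leaf (1 ∷ 4 ∷ 7 ∷ 9 ∷ 13 ∷ [])) ∷
          (nonedge 4F 5F 3F (0 ∷ 1 ∷ 2 ∷ 10 ∷ 14 ∷ [])
           (leaf (0 ∷ 2 ∷ 10 ∷ 14 ∷ []))
           (leaf (0 ∷ 3 ∷ 11 ∷ 13 ∷ []))) ∷
          (leaf (1 ∷ 6 ∷ 7 ∷ 9 ∷ 13 ∷ [])) ∷
          (apart 3F 4F 5F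
           (leaf (0 ∷ 2 ∷ 7 ∷ []))
           (leaf (0 ∷ 3 ∷ 6 ∷ []))) ∷ []))
         (edge 3F 2F (0 ∷ 1 ∷ []) (
          (leaf (1 ∷ 7 ∷ 11 ∷ 11 ∷ 12 ∷ [])) ∷
          (nonedge 5F 4F 1F (0 ∷ 1 ∷ 2 ∷ 11 ∷ 13 ∷ [])
           (leaf (0 ∷ 2 ∷ 11 ∷ 13 ∷ []))
           (leaf (0 ∷ 3 ∷ 10 ∷ 14 ∷ []))) ∷
          (leaf (1 ∷ 5 ∷ 10 ∷ 11 ∷ 14 ∷ [])) ∷
          (leaf (1 ∷ 7 ∷ 11 ∷ [])) ∷
          (nonedge 3F 4F 2F (0 ∷ 1 ∷ 2 ∷ 5 ∷ 6 ∷ [])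
           (leaf (0 ∷ 2 ∷ []))
           (leaf (0 ∷ 3 ∷ []))) ∷
          (leaf (1 ∷ 10 ∷ 14 ∷ [])) ∷ []))) ∷ []))
       (leaf (0 ∷ 3 ∷ 5 ∷ 11 ∷ []))) ∷
      (apart 4F 5F 3F
       (leaf (0 ∷ 3 ∷ 5 ∷ []))
       (leaf (0 ∷ 2 ∷ 6 ∷ []))) ∷
      -- Both `S 0 - S 3` and `S 0 - S 5` equal `S 4`, so `S 3` = `S 5` and the edge 3 5 makes 0 a
      -- label.
      (edge 3F 5F (0 ∷ 2 ∷ 6 ∷ []) (
       (leaf (1 ∷ 3 ∷ 5 ∷ 7 ∷ 11 ∷ [])) ∷
       (nonedge 0F 1F 0F (0 ∷ 11 ∷ [])
        (leaf (0 ∷ 2 ∷ 6 ∷ 8 ∷ []))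
        (leaf (0 ∷ 1 ∷ []))) ∷
       (apart 1F 2F 0F
        (nonedge 1F 2F 1F (0 ∷ 1 ∷ [])
         (leaf (0 ∷ 3 ∷ 7 ∷ 9 ∷ []))
         (leaf (0 ∷ 2 ∷ [])))
        (nonedge 2F 1F 1F (0 ∷ 1 ∷ [])
         (leaf (0 ∷ 1 ∷ 1 ∷ 3 ∷ 7 ∷ 9 ∷ []))
         (edge 3F 1F (0 ∷ 2 ∷ 4 ∷ 8 ∷ 14 ∷ []) (
          (nonedge 2F 1F 4F (0 ∷ 5 ∷ [])
           (leaf (0 ∷ 2 ∷ 8 ∷ 10 ∷ []))
           (leaf (0 ∷ 3 ∷ 7 ∷ 11 ∷ []))) ∷
          (leaf (0 ∷ 0 ∷ 3 ∷ 6 ∷ 10 ∷ 12 ∷ [])) ∷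
          (leaf (2 ∷ 2 ∷ 3 ∷ 6 ∷ 6 ∷ 6 ∷ 10 ∷ 10 ∷ 10 ∷ 12 ∷ 16 ∷ 16 ∷ [])) ∷
          (leaf (2 ∷ 2 ∷ 3 ∷ 6 ∷ 10 ∷ 12 ∷ [])) ∷
          (edge 4F 1F (0 ∷ 0 ∷ 1 ∷ 1 ∷ 4 ∷ 7 ∷ 11 ∷ 13 ∷ []) (
           (nonedge 4F 5F 5F (0 ∷ 6 ∷ 8 ∷ 10 ∷ [])
            (leaf (0 ∷ 2 ∷ 6 ∷ 9 ∷ 10 ∷ 13 ∷ []))
            (leaf (0 ∷ 3 ∷ 5 ∷ 14 ∷ 14 ∷ 16 ∷ []))) ∷
           (leaf (0 ∷ 0 ∷ 6 ∷ 9 ∷ 13 ∷ 15 ∷ [])) ∷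
           (leaf (2 ∷ 2 ∷ 3 ∷ 3 ∷ 6 ∷ 9 ∷ 9 ∷ 9 ∷ 13 ∷ 13 ∷ 13 ∷ 15 ∷ 15 ∷ 15 ∷ [])) ∷
           (leaf (2 ∷ 5 ∷ 6 ∷ 9 ∷ 13 ∷ 15 ∷ [])) ∷
           (leaf (2 ∷ 2 ∷ 6 ∷ 9 ∷ 13 ∷ 15 ∷ [])) ∷
           (leaf (2 ∷ 5 ∷ 6 ∷ 9 ∷ [])) ∷ [])) ∷
          (leaf (2 ∷ 4 ∷ 6 ∷ [])) ∷ [])))) ∷
       (leaf (1 ∷ 5 ∷ 11 ∷ [])) ∷
       (leaf (1 ∷ 5 ∷ 9 ∷ [])) ∷
       (leaf (1 ∷ 5 ∷ 5 ∷ 7 ∷ 11 ∷ [])) ∷ [])) ∷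
      (apart 4F 5F 3F
       (leaf (0 ∷ 3 ∷ 5 ∷ 11 ∷ []))
       (edge 3F 5F (0 ∷ 1 ∷ 3 ∷ 7 ∷ []) (
        (leaf (1 ∷ 3 ∷ 7 ∷ 7 ∷ 8 ∷ [])) ∷
        (nonedge 5F 4F 1F (0 ∷ 4 ∷ [])
         (leaf (0 ∷ 2 ∷ 7 ∷ 9 ∷ []))
         (leaf (0 ∷ 3 ∷ 6 ∷ 10 ∷ []))) ∷
        (nonedge 5F 4F 2F (0 ∷ 4 ∷ [])
         (leaf (0 ∷ 2 ∷ 7 ∷ 9 ∷ []))
         (leaf (0 ∷ 3 ∷ 6 ∷ 10 ∷ []))) ∷
        (leaf (1 ∷ 3 ∷ 7 ∷ [])) ∷
        (nonedge 5F 4F 4F (0 ∷ 4 ∷ [])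
         (leaf (0 ∷ 2 ∷ 7 ∷ 9 ∷ []))
         (leaf (0 ∷ 3 ∷ 6 ∷ 10 ∷ []))) ∷
        (leaf (1 ∷ 6 ∷ 10 ∷ [])) ∷ []))) ∷ [])) ∷
     (edge 0F 4F (0 ∷ 6 ∷ []) (
      (nonedge 3F 4F 3F (0 ∷ 2 ∷ 4 ∷ 11 ∷ [])
       (leaf (0 ∷ 2 ∷ []))
       (leaf (0 ∷ 3 ∷ []))) ∷
      (nonedge 0F 1F 4F (0 ∷ 8 ∷ [])
       (leaf (0 ∷ 2 ∷ []))
       (leaf (0 ∷ 3 ∷ []))) ∷
      (apart 2F 5F 1F
       (edge 2F 5F (0 ∷ 1 ∷ []) (
        (leaf (1 ∷ 9 ∷ 10 ∷ 13 ∷ [])) ∷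
        (nonedge 3F 4F 1F (0 ∷ 1 ∷ 2 ∷ 6 ∷ 10 ∷ [])
         (leaf (0 ∷ 2 ∷ 6 ∷ 10 ∷ []))
         (leaf (0 ∷ 3 ∷ 7 ∷ 9 ∷ []))) ∷
        (leaf (1 ∷ 9 ∷ 10 ∷ [])) ∷
        (nonedge 5F 4F 5F (0 ∷ 2 ∷ 6 ∷ 8 ∷ 10 ∷ [])
         (leaf (0 ∷ 2 ∷ 6 ∷ 10 ∷ []))
         (leaf (0 ∷ 3 ∷ 7 ∷ 9 ∷ []))) ∷
        (nonedge 3F 4F 4F (0 ∷ 1 ∷ 2 ∷ 6 ∷ 10 ∷ [])
         (leaf (0 ∷ 2 ∷ 6 ∷ 10 ∷ []))
         (leaf (0 ∷ 3 ∷ 7 ∷ 9 ∷ []))) ∷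
        (nonedge 3F 4F 5F (0 ∷ 1 ∷ 2 ∷ 6 ∷ 10 ∷ [])
         (leaf (0 ∷ 2 ∷ 6 ∷ 10 ∷ []))
         (leaf (0 ∷ 3 ∷ 7 ∷ 9 ∷ []))) ∷ []))
       (edge 5F 2F (0 ∷ 1 ∷ []) (
        (leaf (1 ∷ 3 ∷ 4 ∷ 4 ∷ 8 ∷ 14 ∷ [])) ∷
        (nonedge 4F 3F 1F (0 ∷ 1 ∷ 2 ∷ 7 ∷ 9 ∷ [])
         (leaf (0 ∷ 2 ∷ 7 ∷ 9 ∷ []))
         (leaf (0 ∷ 3 ∷ 6 ∷ 10 ∷ []))) ∷
        (nonedge 4F 3F 2F (0 ∷ 1 ∷ 2 ∷ 7 ∷ 9 ∷ [])
         (leaf (0 ∷ 2 ∷ 7 ∷ 9 ∷ []))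
         (leaf (0 ∷ 3 ∷ 6 ∷ 10 ∷ []))) ∷
        (leaf (1 ∷ 6 ∷ 12 ∷ 14 ∷ [])) ∷
        (leaf (1 ∷ 3 ∷ 4 ∷ 6 ∷ 8 ∷ 14 ∷ [])) ∷
        (leaf (1 ∷ 6 ∷ 12 ∷ [])) ∷ []))) ∷
      (apart 4F 5F 3F
       (leaf (0 ∷ 2 ∷ 6 ∷ []))
       (leaf (0 ∷ 3 ∷ 5 ∷ []))) ∷
      -- Here `S 0` is both 2 S 4 and S 3 + S 5, so `S 5`, `S 4`, `S 3` are in arithmetic
      -- progression; as `S 5 ≤ S 3`, the branch `S 3 < S 4` closes at once.
      (apart 3F 4F 5F
       (edge 3F 5F (0 ∷ 1 ∷ 1 ∷ 4 ∷ 6 ∷ []) (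
        (leaf (1 ∷ 7 ∷ 10 ∷ [])) ∷
        (apart 1F 4F 0F
         (edge 1F 4F (0 ∷ 1 ∷ []) (
          (leaf (1 ∷ 3 ∷ 5 ∷ 5 ∷ 10 ∷ 11 ∷ 11 ∷ 11 ∷ 11 ∷ 12 ∷ 12 ∷ [])) ∷
          (leaf (1 ∷ 3 ∷ 5 ∷ 10 ∷ 11 ∷ 11 ∷ 12 ∷ [])) ∷
          (nonedge 1F 2F 4F (0 ∷ 2 ∷ 9 ∷ [])
           (leaf (0 ∷ 2 ∷ []))
           (leaf (0 ∷ 3 ∷ []))) ∷
          (leaf (1 ∷ 3 ∷ 5 ∷ 5 ∷ 10 ∷ 11 ∷ 11 ∷ 11 ∷ 12 ∷ [])) ∷
          (leaf (1 ∷ 5 ∷ 10 ∷ 11 ∷ 14 ∷ [])) ∷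
          (edge 0F 2F (0 ∷ 18 ∷ []) (
           (nonedge 1F 2F 1F (0 ∷ 2 ∷ 8 ∷ [])
            (leaf (0 ∷ 2 ∷ []))
            (leaf (0 ∷ 3 ∷ []))) ∷
           (nonedge 4F 5F 2F (0 ∷ 0 ∷ 1 ∷ 9 ∷ 14 ∷ 16 ∷ [])
            (leaf (0 ∷ 2 ∷ 5 ∷ 14 ∷ []))
            (leaf (0 ∷ 3 ∷ 6 ∷ 13 ∷ []))) ∷
           (apart 2F 4F 1F
            (leaf (0 ∷ 0 ∷ 2 ∷ 14 ∷ []))
            (leaf (0 ∷ 0 ∷ 3 ∷ 13 ∷ []))) ∷
           (apart 2F 5F 1F
            (leaf (0 ∷ 2 ∷ 17 ∷ []))
            (leaf (0 ∷ 3 ∷ 16 ∷ []))) ∷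
           (apart 2F 4F 1F
            (leaf (0 ∷ 2 ∷ 14 ∷ []))
            (leaf (0 ∷ 3 ∷ 13 ∷ []))) ∷
           (apart 2F 3F 1F
            (leaf (0 ∷ 2 ∷ 17 ∷ []))
            (leaf (0 ∷ 3 ∷ 16 ∷ []))) ∷ [])) ∷ []))
         (edge 4F 1F (0 ∷ 1 ∷ []) (
          (leaf (1 ∷ 3 ∷ 4 ∷ 4 ∷ 9 ∷ [])) ∷
          (edge 5F 1F (0 ∷ 2 ∷ 7 ∷ 8 ∷ []) (
           (leaf (0 ∷ 1 ∷ 1 ∷ 5 ∷ 5 ∷ 5 ∷ 6 ∷ 6 ∷ 6 ∷ 8 ∷ 15 ∷ [])) ∷
           (leaf (1 ∷ 1 ∷ 5 ∷ 5 ∷ 5 ∷ 6 ∷ 8 ∷ 13 ∷ 15 ∷ [])) ∷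
           (nonedge 4F 5F 2F (0 ∷ 0 ∷ 4 ∷ 9 ∷ 14 ∷ 16 ∷ [])
            (leaf (0 ∷ 2 ∷ 6 ∷ 9 ∷ 14 ∷ 16 ∷ []))
            (leaf (0 ∷ 3 ∷ 5 ∷ 10 ∷ 13 ∷ 17 ∷ []))) ∷
           (leaf (1 ∷ 5 ∷ 5 ∷ 6 ∷ 6 ∷ 8 ∷ [])) ∷
           (leaf (1 ∷ 1 ∷ 5 ∷ 5 ∷ 5 ∷ 6 ∷ 6 ∷ 6 ∷ 8 ∷ 13 ∷ 15 ∷ [])) ∷
           (leaf (1 ∷ 5 ∷ 6 ∷ [])) ∷ [])) ∷
          (apart 1F 4F 0F
           (leaf (0 ∷ 1 ∷ 2 ∷ []))
           (edge 0F 2F (0 ∷ 1 ∷ 3 ∷ 6 ∷ 6 ∷ 11 ∷ []) (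
            (leaf (1 ∷ 3 ∷ 6 ∷ [])) ∷
            (leaf (0 ∷ 2 ∷ 3 ∷ 5 ∷ 13 ∷ [])) ∷
            (leaf (2 ∷ 5 ∷ 5 ∷ 8 ∷ 10 ∷ 11 ∷ 11 ∷ 16 ∷ [])) ∷
            (leaf (2 ∷ 5 ∷ 10 ∷ 11 ∷ 16 ∷ [])) ∷
            (leaf (2 ∷ 5 ∷ 10 ∷ 11 ∷ 11 ∷ 16 ∷ [])) ∷
            (leaf (2 ∷ 5 ∷ 8 ∷ 11 ∷ 16 ∷ [])) ∷ []))) ∷
          (leaf (1 ∷ 4 ∷ 7 ∷ [])) ∷
          (leaf (1 ∷ 6 ∷ 7 ∷ 7 ∷ 10 ∷ 12 ∷ [])) ∷
          (leaf (1 ∷ 6 ∷ 7 ∷ [])) ∷ []))) ∷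
        (apart 2F 4F 1F
         (edge 2F 4F (0 ∷ 1 ∷ []) (
          (leaf (1 ∷ 3 ∷ 5 ∷ 5 ∷ 10 ∷ 11 ∷ 11 ∷ 11 ∷ 11 ∷ 12 ∷ 12 ∷ [])) ∷
          (nonedge 2F 1F 4F (0 ∷ 2 ∷ 9 ∷ [])
           (leaf (0 ∷ 2 ∷ []))
           (leaf (0 ∷ 3 ∷ []))) ∷
          (leaf (1 ∷ 3 ∷ 5 ∷ 10 ∷ 11 ∷ 11 ∷ 12 ∷ [])) ∷
          (leaf (1 ∷ 3 ∷ 5 ∷ 5 ∷ 10 ∷ 11 ∷ 11 ∷ 11 ∷ 12 ∷ [])) ∷
          (leaf (1 ∷ 5 ∷ 10 ∷ 11 ∷ 14 ∷ [])) ∷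
          (edge 0F 2F (0 ∷ 1 ∷ 1 ∷ 6 ∷ 13 ∷ []) (
           (leaf (1 ∷ 6 ∷ 11 ∷ [])) ∷
           (nonedge 4F 5F 1F (0 ∷ 1 ∷ 2 ∷ 5 ∷ 14 ∷ [])
            (leaf (0 ∷ 2 ∷ 5 ∷ 14 ∷ []))
            (leaf (0 ∷ 3 ∷ 6 ∷ 13 ∷ []))) ∷
           (leaf (1 ∷ 6 ∷ 6 ∷ 13 ∷ [])) ∷
           (leaf (1 ∷ 3 ∷ 6 ∷ 6 ∷ 8 ∷ 13 ∷ [])) ∷
           (leaf (1 ∷ 6 ∷ 13 ∷ [])) ∷
           (leaf (2 ∷ 5 ∷ 6 ∷ 8 ∷ 15 ∷ [])) ∷ [])) ∷ []))
         (edge 4F 2F (0 ∷ 1 ∷ []) (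
          (leaf (1 ∷ 3 ∷ 4 ∷ 4 ∷ 9 ∷ [])) ∷
          (apart 2F 4F 1F
           (leaf (0 ∷ 1 ∷ 2 ∷ []))
           (edge 5F 1F (0 ∷ 3 ∷ 8 ∷ 9 ∷ []) (
            (leaf (0 ∷ 1 ∷ 1 ∷ 3 ∷ 3 ∷ 6 ∷ 6 ∷ 8 ∷ 9 ∷ 16 ∷ [])) ∷
            (apart 2F 5F 1F
             (leaf (0 ∷ 3 ∷ 6 ∷ 6 ∷ 11 ∷ 14 ∷ 18 ∷ []))
             (leaf (0 ∷ 2 ∷ 7 ∷ 7 ∷ 10 ∷ 15 ∷ 17 ∷ []))) ∷
            (leaf (1 ∷ 6 ∷ 11 ∷ 14 ∷ 16 ∷ [])) ∷
            (leaf (1 ∷ 3 ∷ 6 ∷ 8 ∷ 9 ∷ [])) ∷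
            (leaf (0 ∷ 1 ∷ 1 ∷ 3 ∷ 6 ∷ 6 ∷ 9 ∷ 14 ∷ 16 ∷ [])) ∷
            (leaf (1 ∷ 3 ∷ 6 ∷ [])) ∷ []))) ∷
          (edge 0F 2F (0 ∷ 1 ∷ 1 ∷ 1 ∷ 2 ∷ 2 ∷ 10 ∷ []) (
           (leaf (1 ∷ 5 ∷ 6 ∷ [])) ∷
           (nonedge 0F 1F 2F (0 ∷ 2 ∷ 4 ∷ [])
            (leaf (0 ∷ 2 ∷ []))
            (leaf (0 ∷ 3 ∷ []))) ∷
           (leaf (2 ∷ 6 ∷ 6 ∷ 12 ∷ [])) ∷
           (leaf (2 ∷ 4 ∷ 9 ∷ 10 ∷ 15 ∷ [])) ∷
           (leaf (2 ∷ 6 ∷ 12 ∷ [])) ∷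
           (leaf (2 ∷ 3 ∷ 4 ∷ 10 ∷ 15 ∷ [])) ∷ [])) ∷
          (leaf (1 ∷ 4 ∷ 7 ∷ [])) ∷
          (leaf (1 ∷ 6 ∷ 7 ∷ 7 ∷ 10 ∷ 12 ∷ [])) ∷
          (leaf (1 ∷ 6 ∷ 7 ∷ [])) ∷ []))) ∷
        (leaf (1 ∷ 9 ∷ 10 ∷ [])) ∷
        (nonedge 3F 4F 5F (0 ∷ 4 ∷ [])
         (leaf (0 ∷ 2 ∷ []))
         (leaf (0 ∷ 3 ∷ []))) ∷
        (edge 0F 2F (0 ∷ 14 ∷ []) (
         (apart 1F 2F 0F
          (nonedge 1F 2F 1F (0 ∷ 1 ∷ [])
           (leaf (0 ∷ 3 ∷ []))
           (leaf (0 ∷ 4 ∷ [])))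
          (nonedge 2F 1F 1F (0 ∷ 1 ∷ [])
           (leaf (0 ∷ 1 ∷ 1 ∷ 3 ∷ []))
           (edge 3F 1F (0 ∷ 0 ∷ 1 ∷ 4 ∷ 6 ∷ 6 ∷ 6 ∷ 6 ∷ 7 ∷ 7 ∷ []) (
            (nonedge 2F 1F 5F (0 ∷ 5 ∷ [])
             (leaf (0 ∷ 2 ∷ 8 ∷ 17 ∷ []))
             (leaf (0 ∷ 3 ∷ 7 ∷ 18 ∷ []))) ∷
            (leaf (0 ∷ 0 ∷ 3 ∷ 6 ∷ [])) ∷
            (leaf (2 ∷ 2 ∷ 3 ∷ 6 ∷ 6 ∷ 6 ∷ 8 ∷ 8 ∷ 8 ∷ 8 ∷ 9 ∷ 9 ∷ [])) ∷
            (leaf (2 ∷ 2 ∷ 3 ∷ 6 ∷ [])) ∷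
            (leaf (2 ∷ 2 ∷ 3 ∷ 6 ∷ 11 ∷ 11 ∷ [])) ∷
            (leaf (0 ∷ 0 ∷ 2 ∷ 2 ∷ 3 ∷ 6 ∷ 9 ∷ 9 ∷ [])) ∷ [])))) ∷
         (nonedge 0F 1F 2F (0 ∷ 15 ∷ [])
          (leaf (0 ∷ 2 ∷ []))
          (leaf (0 ∷ 3 ∷ []))) ∷
         (apart 2F 4F 1F
          (leaf (0 ∷ 0 ∷ 2 ∷ 10 ∷ []))
          (leaf (0 ∷ 0 ∷ 3 ∷ 9 ∷ []))) ∷
         (apart 2F 5F 1F
          (leaf (0 ∷ 2 ∷ 13 ∷ []))
          (leaf (0 ∷ 3 ∷ 12 ∷ []))) ∷
         (apart 2F 4F 1F
          (leaf (0 ∷ 2 ∷ 10 ∷ []))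
          (leaf (0 ∷ 3 ∷ 9 ∷ []))) ∷
         (apart 2F 3F 1F
          (leaf (0 ∷ 2 ∷ 13 ∷ []))
          (leaf (0 ∷ 3 ∷ 12 ∷ []))) ∷ [])) ∷ []))
       (leaf (0 ∷ 0 ∷ 2 ∷ 6 ∷ 11 ∷ []))) ∷
      (apart 3F 4F 5F
       (leaf (0 ∷ 3 ∷ 5 ∷ []))
       (leaf (0 ∷ 2 ∷ 6 ∷ []))) ∷ [])) ∷ []))
    (leaf (0 ∷ 6 ∷ [])))
   (leaf (0 ∷ 4 ∷ [])))
  (leaf (0 ∷ 5 ∷ [])))

-- The root hypotheses are those of `order₁`. As 1 is the middle of its path, a difference
-- `S 1 - S j` can be neither `S 0` nor `S 2`: the non-edges 1 0 and 1 2 forbid both.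
max-at-1 : Cert 6
max-at-1 =
 (apart 1F 3F 0F
  (apart 1F 2F 0F
   (apart 0F 1F 2F
    (leaf (0 ∷ 5 ∷ []))
    (apart 1F 4F 0F
     (edge 1F 4F (0 ∷ 1 ∷ []) (
      (nonedge 1F 0F 4F (0 ∷ 5 ∷ [])
       (leaf (0 ∷ 2 ∷ []))
       (leaf (0 ∷ 3 ∷ []))) ∷
      -- Here `S 4` = 0. A positive `S 3` violates the non-edge 3 4; a negative one makes
      -- `S 1 - S 3` exceed the maximum.
      (apart 3F 4F 5F
       (nonedge 3F 4F 3F (0 ∷ 1 ∷ [])
        (leaf (0 ∷ 3 ∷ []))
        (leaf (0 ∷ 4 ∷ [])))
       (nonedge 4F 3F 3F (0 ∷ 1 ∷ [])
        (leaf (0 ∷ 1 ∷ 1 ∷ 3 ∷ []))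
        (edge 1F 3F (0 ∷ 0 ∷ 1 ∷ 3 ∷ 3 ∷ 4 ∷ []) (
         (leaf (2 ∷ 2 ∷ 3 ∷ 6 ∷ 9 ∷ 9 ∷ [])) ∷
         (leaf (2 ∷ 2 ∷ 3 ∷ 6 ∷ [])) ∷
         (leaf (2 ∷ 2 ∷ 3 ∷ 6 ∷ 10 ∷ 10 ∷ [])) ∷
         (leaf (0 ∷ 0 ∷ 3 ∷ 6 ∷ [])) ∷
         (leaf (2 ∷ 2 ∷ 3 ∷ 5 ∷ 5 ∷ 6 ∷ 6 ∷ 6 ∷ [])) ∷
         (leaf (0 ∷ 0 ∷ 3 ∷ 6 ∷ 13 ∷ 13 ∷ [])) ∷ [])))) ∷
      (nonedge 1F 2F 4F (0 ∷ 6 ∷ [])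
       (leaf (0 ∷ 2 ∷ []))
       (leaf (0 ∷ 3 ∷ []))) ∷
      (edge 1F 5F (0 ∷ 7 ∷ 9 ∷ []) (
       (nonedge 1F 0F 5F (0 ∷ 8 ∷ [])
        (leaf (0 ∷ 2 ∷ []))
        (leaf (0 ∷ 3 ∷ []))) ∷
       (nonedge 4F 5F 4F (0 ∷ 2 ∷ 6 ∷ 10 ∷ [])
        (leaf (0 ∷ 2 ∷ []))
        (leaf (0 ∷ 3 ∷ []))) ∷
       (nonedge 1F 2F 5F (0 ∷ 9 ∷ [])
        (leaf (0 ∷ 2 ∷ []))
        (leaf (0 ∷ 3 ∷ []))) ∷
       (apart 4F 5F 3F
        (leaf (0 ∷ 3 ∷ 5 ∷ []))
        (leaf (0 ∷ 2 ∷ 6 ∷ []))) ∷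
       (edge 3F 5F (0 ∷ 2 ∷ 6 ∷ []) (
        (nonedge 1F 0F 1F (0 ∷ 2 ∷ 4 ∷ 6 ∷ 7 ∷ 8 ∷ 8 ∷ [])
         (leaf (0 ∷ 2 ∷ 6 ∷ 8 ∷ []))
         (leaf (0 ∷ 1 ∷ []))) ∷
        (leaf (1 ∷ 3 ∷ 5 ∷ 7 ∷ 9 ∷ [])) ∷
        (nonedge 1F 2F 1F (0 ∷ 2 ∷ 4 ∷ 6 ∷ 7 ∷ 8 ∷ 8 ∷ [])
         (leaf (0 ∷ 2 ∷ 6 ∷ 8 ∷ []))
         (leaf (0 ∷ 1 ∷ []))) ∷
        (leaf (1 ∷ 5 ∷ 9 ∷ [])) ∷
        (leaf (1 ∷ 5 ∷ 12 ∷ [])) ∷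
        (leaf (1 ∷ 5 ∷ 5 ∷ 7 ∷ 9 ∷ [])) ∷ [])) ∷
       (apart 4F 5F 3F
        (leaf (0 ∷ 3 ∷ 5 ∷ 12 ∷ []))
        (edge 3F 5F (0 ∷ 1 ∷ 3 ∷ 7 ∷ []) (
         (nonedge 5F 4F 0F (0 ∷ 4 ∷ [])
          (leaf (0 ∷ 2 ∷ 7 ∷ 9 ∷ []))
          (leaf (0 ∷ 3 ∷ 6 ∷ 10 ∷ []))) ∷
         (leaf (1 ∷ 4 ∷ 13 ∷ [])) ∷
         (nonedge 5F 4F 2F (0 ∷ 4 ∷ [])
          (leaf (0 ∷ 2 ∷ 7 ∷ 9 ∷ []))
          (leaf (0 ∷ 3 ∷ 6 ∷ 10 ∷ []))) ∷
         (leaf (0 ∷ 1 ∷ 1 ∷ 6 ∷ 13 ∷ [])) ∷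
         (nonedge 5F 4F 4F (0 ∷ 4 ∷ [])
          (leaf (0 ∷ 2 ∷ 7 ∷ 9 ∷ []))
          (leaf (0 ∷ 3 ∷ 6 ∷ 10 ∷ []))) ∷
         (leaf (1 ∷ 6 ∷ 13 ∷ [])) ∷ []))) ∷ [])) ∷
      (edge 1F 5F (0 ∷ 7 ∷ 9 ∷ []) (
       (nonedge 1F 0F 5F (0 ∷ 8 ∷ [])
        (leaf (0 ∷ 2 ∷ []))
        (leaf (0 ∷ 3 ∷ []))) ∷
       (nonedge 4F 5F 4F (0 ∷ 2 ∷ 4 ∷ [])
        (leaf (0 ∷ 2 ∷ []))
        (leaf (0 ∷ 3 ∷ []))) ∷
       (nonedge 1F 2F 5F (0 ∷ 9 ∷ [])
        (leaf (0 ∷ 2 ∷ []))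
        (leaf (0 ∷ 3 ∷ []))) ∷
       -- With `S 1` = 2 S 4, this is the case `S 1` = S 3 + S 5, whose siblings all close after one
       -- split. Again `S 5`, `S 4`, `S 3` are in arithmetic progression, and `S 4 < S 5` is
       -- impossible by `S 5 ≤ S 3`.
       (apart 4F 5F 3F
        (apart 2F 3F 1F
         (edge 2F 3F (0 ∷ 1 ∷ []) (
          (leaf (1 ∷ 4 ∷ 7 ∷ 8 ∷ 9 ∷ 15 ∷ [])) ∷
          (leaf (1 ∷ 5 ∷ 13 ∷ [])) ∷
          (leaf (1 ∷ 4 ∷ 7 ∷ 8 ∷ 9 ∷ [])) ∷
          (leaf (1 ∷ 4 ∷ 4 ∷ 7 ∷ 7 ∷ 9 ∷ 13 ∷ [])) ∷
          (leaf (1 ∷ 4 ∷ 7 ∷ 13 ∷ [])) ∷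
          (leaf (1 ∷ 7 ∷ 13 ∷ [])) ∷ []))
         (edge 3F 2F (0 ∷ 1 ∷ []) (
          (apart 0F 4F 1F
           (edge 0F 4F (0 ∷ 1 ∷ []) (
            (leaf (1 ∷ 14 ∷ 15 ∷ [])) ∷
            (leaf (1 ∷ 12 ∷ 16 ∷ [])) ∷
            (edge 4F 2F (0 ∷ 2 ∷ 15 ∷ 17 ∷ []) (
             (leaf (1 ∷ 3 ∷ 6 ∷ [])) ∷
             (leaf (0 ∷ 1 ∷ 1 ∷ 5 ∷ 5 ∷ 6 ∷ 6 ∷ 16 ∷ [])) ∷
             (leaf (2 ∷ 4 ∷ 8 ∷ 17 ∷ 21 ∷ [])) ∷
             (leaf (1 ∷ 3 ∷ 3 ∷ 6 ∷ 8 ∷ [])) ∷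
             (leaf (1 ∷ 5 ∷ 6 ∷ [])) ∷
             (leaf (2 ∷ 6 ∷ 8 ∷ 13 ∷ 17 ∷ [])) ∷ [])) ∷
            (leaf (1 ∷ 8 ∷ 11 ∷ 16 ∷ [])) ∷
            (leaf (1 ∷ 14 ∷ 16 ∷ [])) ∷
            (edge 3F 5F (0 ∷ 9 ∷ 9 ∷ 12 ∷ 14 ∷ []) (
             (apart 2F 5F 1F
              (leaf (0 ∷ 3 ∷ 9 ∷ []))
              (leaf (0 ∷ 2 ∷ 10 ∷ []))) ∷
             (leaf (1 ∷ 5 ∷ 5 ∷ 6 ∷ 6 ∷ 13 ∷ [])) ∷
             (leaf (2 ∷ 3 ∷ 4 ∷ 8 ∷ 11 ∷ [])) ∷
             (leaf (1 ∷ 5 ∷ 6 ∷ [])) ∷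
             (apart 0F 3F 1F
              (leaf (0 ∷ 2 ∷ 6 ∷ []))
              (leaf (0 ∷ 3 ∷ 5 ∷ []))) ∷
             (edge 0F 3F (0 ∷ 3 ∷ 5 ∷ 12 ∷ []) (
              (leaf (1 ∷ 4 ∷ 8 ∷ 8 ∷ 9 ∷ 9 ∷ [])) ∷
              (leaf (0 ∷ 1 ∷ 1 ∷ 4 ∷ 4 ∷ 8 ∷ 8 ∷ 8 ∷ 8 ∷ 9 ∷ 9 ∷ 19 ∷ [])) ∷
              (leaf (0 ∷ 5 ∷ 7 ∷ 11 ∷ 14 ∷ [])) ∷
              (leaf (1 ∷ 1 ∷ 4 ∷ 4 ∷ 4 ∷ 8 ∷ 8 ∷ 8 ∷ 8 ∷ 8 ∷ 9 ∷ 9 ∷ 9 ∷ 17 ∷ 19 ∷ [])) ∷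
              (leaf (1 ∷ 4 ∷ 8 ∷ 8 ∷ 9 ∷ [])) ∷
              (leaf (1 ∷ 1 ∷ 4 ∷ 8 ∷ 8 ∷ 8 ∷ 9 ∷ 17 ∷ 19 ∷ [])) ∷ [])) ∷ [])) ∷ []))
           (edge 4F 0F (0 ∷ 1 ∷ []) (
            (leaf (1 ∷ 6 ∷ 8 ∷ 11 ∷ 13 ∷ 19 ∷ [])) ∷
            (leaf (1 ∷ 3 ∷ 4 ∷ 4 ∷ 13 ∷ [])) ∷
            (leaf (1 ∷ 6 ∷ 8 ∷ 11 ∷ 13 ∷ [])) ∷
            (leaf (1 ∷ 4 ∷ 8 ∷ 11 ∷ 13 ∷ [])) ∷
            (leaf (1 ∷ 6 ∷ 7 ∷ [])) ∷
            (leaf (1 ∷ 3 ∷ 6 ∷ 11 ∷ 13 ∷ 19 ∷ [])) ∷ []))) ∷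
          (edge 4F 2F (0 ∷ 2 ∷ 5 ∷ 8 ∷ 15 ∷ 15 ∷ []) (
           (apart 0F 3F 1F
            (edge 0F 3F (0 ∷ 1 ∷ []) (
             (leaf (1 ∷ 1 ∷ 7 ∷ 11 ∷ 11 ∷ 14 ∷ 14 ∷ 16 ∷ [])) ∷
             (leaf (0 ∷ 1 ∷ 1 ∷ 5 ∷ 5 ∷ 9 ∷ 9 ∷ 11 ∷ 11 ∷ 11 ∷ 11 ∷ 14 ∷ 14 ∷ 14 ∷ 14 ∷ 16 ∷ 16 ∷ 16 ∷ [])) ∷
             (leaf (0 ∷ 0 ∷ 0 ∷ 3 ∷ 4 ∷ 5 ∷ 5 ∷ 8 ∷ 16 ∷ [])) ∷
             (leaf (1 ∷ 5 ∷ 9 ∷ 11 ∷ 11 ∷ 11 ∷ 14 ∷ 14 ∷ 14 ∷ 16 ∷ 16 ∷ [])) ∷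
             (leaf (1 ∷ 5 ∷ 9 ∷ 11 ∷ 11 ∷ 14 ∷ 14 ∷ 16 ∷ [])) ∷
             (leaf (1 ∷ 5 ∷ 9 ∷ 11 ∷ 14 ∷ 14 ∷ 16 ∷ [])) ∷ []))
            (edge 3F 0F (0 ∷ 1 ∷ []) (
             (leaf (1 ∷ 6 ∷ 6 ∷ 8 ∷ 8 ∷ 17 ∷ 21 ∷ 21 ∷ 21 ∷ [])) ∷
             (leaf (1 ∷ 4 ∷ 21 ∷ [])) ∷
             (leaf (2 ∷ 2 ∷ 2 ∷ 3 ∷ 3 ∷ 4 ∷ 5 ∷ 5 ∷ 8 ∷ 16 ∷ [])) ∷
             (leaf (1 ∷ 6 ∷ 8 ∷ 11 ∷ 14 ∷ 21 ∷ 21 ∷ [])) ∷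
             (leaf (1 ∷ 6 ∷ 8 ∷ 17 ∷ 21 ∷ 21 ∷ [])) ∷
             (edge 5F 2F (0 ∷ 1 ∷ 1 ∷ 9 ∷ 14 ∷ []) (
              (leaf (1 ∷ 9 ∷ 14 ∷ [])) ∷
              (leaf (0 ∷ 1 ∷ 1 ∷ 4 ∷ 9 ∷ 12 ∷ 14 ∷ [])) ∷
              (leaf (0 ∷ 5 ∷ 6 ∷ 11 ∷ 16 ∷ [])) ∷
              (leaf (1 ∷ 3 ∷ 4 ∷ 9 ∷ 14 ∷ [])) ∷
              (leaf (1 ∷ 1 ∷ 4 ∷ 9 ∷ 12 ∷ 14 ∷ 20 ∷ [])) ∷
              (leaf (2 ∷ 5 ∷ 6 ∷ 11 ∷ 16 ∷ [])) ∷ [])) ∷ []))) ∷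
           (leaf (1 ∷ 5 ∷ 7 ∷ 10 ∷ 12 ∷ [])) ∷
           (leaf (0 ∷ 4 ∷ 17 ∷ [])) ∷
           (nonedge 3F 4F 5F (0 ∷ 0 ∷ 0 ∷ 1 ∷ 3 ∷ 5 ∷ 13 ∷ [])
            (leaf (0 ∷ 3 ∷ 5 ∷ 10 ∷ []))
            (leaf (0 ∷ 2 ∷ 6 ∷ 11 ∷ []))) ∷
           (leaf (2 ∷ 4 ∷ 17 ∷ [])) ∷
           (leaf (0 ∷ 2 ∷ 4 ∷ 7 ∷ 9 ∷ [])) ∷ [])) ∷
          (edge 4F 2F (0 ∷ 0 ∷ 2 ∷ 11 ∷ 15 ∷ []) (
           (leaf (1 ∷ 5 ∷ 7 ∷ 10 ∷ 12 ∷ 18 ∷ [])) ∷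
           (leaf (0 ∷ 1 ∷ 1 ∷ 5 ∷ 5 ∷ 6 ∷ 6 ∷ 12 ∷ [])) ∷
           (leaf (1 ∷ 5 ∷ 7 ∷ 10 ∷ 12 ∷ [])) ∷
           (leaf (1 ∷ 3 ∷ 7 ∷ 10 ∷ 12 ∷ [])) ∷
           (leaf (1 ∷ 5 ∷ 6 ∷ [])) ∷
           (leaf (1 ∷ 1 ∷ 5 ∷ 10 ∷ 10 ∷ 12 ∷ 17 ∷ [])) ∷ [])) ∷
          (nonedge 1F 2F 1F (0 ∷ 2 ∷ 9 ∷ 9 ∷ 10 ∷ [])
           (leaf (0 ∷ 2 ∷ []))
           (leaf (0 ∷ 3 ∷ []))) ∷
          (nonedge 4F 5F 2F (0 ∷ 5 ∷ [])
           (leaf (0 ∷ 2 ∷ 7 ∷ 11 ∷ []))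
           (leaf (0 ∷ 3 ∷ 8 ∷ 10 ∷ []))) ∷
          (apart 2F 5F 1F
           (edge 2F 5F (0 ∷ 1 ∷ []) (
            (leaf (1 ∷ 6 ∷ 7 ∷ 19 ∷ [])) ∷
            (leaf (1 ∷ 4 ∷ 4 ∷ 7 ∷ 10 ∷ [])) ∷
            (leaf (1 ∷ 6 ∷ 7 ∷ [])) ∷
            (leaf (1 ∷ 4 ∷ 7 ∷ [])) ∷
            (edge 0F 4F (0 ∷ 2 ∷ 5 ∷ 20 ∷ []) (
             (leaf (1 ∷ 5 ∷ 6 ∷ [])) ∷
             (leaf (1 ∷ 3 ∷ 19 ∷ [])) ∷
             (leaf (1 ∷ 4 ∷ 7 ∷ 17 ∷ 19 ∷ [])) ∷
             (leaf (1 ∷ 11 ∷ 14 ∷ 19 ∷ [])) ∷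
             (leaf (1 ∷ 17 ∷ 19 ∷ [])) ∷
             (edge 0F 2F (0 ∷ 2 ∷ 6 ∷ []) (
              (leaf (1 ∷ 3 ∷ 9 ∷ [])) ∷
              (leaf (1 ∷ 3 ∷ 3 ∷ 3 ∷ 5 ∷ 7 ∷ 9 ∷ 11 ∷ 16 ∷ [])) ∷
              (leaf (1 ∷ 3 ∷ 5 ∷ 7 ∷ 9 ∷ [])) ∷
              (leaf (1 ∷ 3 ∷ 3 ∷ 5 ∷ 7 ∷ 9 ∷ 11 ∷ [])) ∷
              (leaf (1 ∷ 5 ∷ 9 ∷ [])) ∷
              (leaf (1 ∷ 5 ∷ 7 ∷ 12 ∷ 13 ∷ [])) ∷ [])) ∷ [])) ∷
            (apart 2F 4F 1F
             (leaf (0 ∷ 0 ∷ 3 ∷ 6 ∷ 11 ∷ 15 ∷ []))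
             (leaf (0 ∷ 0 ∷ 2 ∷ 7 ∷ 12 ∷ 14 ∷ []))) ∷ []))
           (edge 5F 2F (0 ∷ 1 ∷ []) (
            (edge 4F 2F (0 ∷ 1 ∷ 2 ∷ 9 ∷ []) (
             (leaf (2 ∷ 4 ∷ 11 ∷ [])) ∷
             (leaf (1 ∷ 9 ∷ 11 ∷ 12 ∷ 16 ∷ [])) ∷
             (leaf (2 ∷ 4 ∷ 11 ∷ 22 ∷ [])) ∷
             (leaf (1 ∷ 9 ∷ 11 ∷ 11 ∷ 11 ∷ 14 ∷ 14 ∷ 16 ∷ 16 ∷ [])) ∷
             (leaf (1 ∷ 9 ∷ 11 ∷ 11 ∷ 14 ∷ 16 ∷ [])) ∷
             (leaf (1 ∷ 9 ∷ 11 ∷ 14 ∷ 16 ∷ [])) ∷ [])) ∷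
            (leaf (1 ∷ 6 ∷ 8 ∷ 8 ∷ 9 ∷ 13 ∷ [])) ∷
            (edge 4F 2F (0 ∷ 1 ∷ 2 ∷ 9 ∷ []) (
             (edge 0F 2F (0 ∷ 3 ∷ 5 ∷ 12 ∷ []) (
              (leaf (1 ∷ 8 ∷ 9 ∷ [])) ∷
              (leaf (0 ∷ 1 ∷ 1 ∷ 4 ∷ 4 ∷ 8 ∷ 8 ∷ 8 ∷ 8 ∷ 9 ∷ 9 ∷ 9 ∷ 9 ∷ 19 ∷ [])) ∷
              (leaf (1 ∷ 1 ∷ 4 ∷ 4 ∷ 8 ∷ 8 ∷ 8 ∷ 9 ∷ 12 ∷ 17 ∷ 19 ∷ [])) ∷
              (leaf (0 ∷ 1 ∷ 1 ∷ 4 ∷ 4 ∷ 8 ∷ 8 ∷ 8 ∷ 9 ∷ 9 ∷ 17 ∷ 19 ∷ [])) ∷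
              (leaf (1 ∷ 4 ∷ 8 ∷ 8 ∷ 9 ∷ 9 ∷ [])) ∷
              (leaf (1 ∷ 1 ∷ 4 ∷ 4 ∷ 8 ∷ 8 ∷ 8 ∷ 9 ∷ 9 ∷ 9 ∷ 12 ∷ 17 ∷ 19 ∷ [])) ∷ [])) ∷
             (leaf (0 ∷ 1 ∷ 1 ∷ 5 ∷ 5 ∷ 6 ∷ 6 ∷ 16 ∷ [])) ∷
             (leaf (2 ∷ 4 ∷ 11 ∷ [])) ∷
             (leaf (1 ∷ 1 ∷ 5 ∷ 5 ∷ 5 ∷ 6 ∷ 6 ∷ 6 ∷ 8 ∷ 14 ∷ 16 ∷ [])) ∷
             (leaf (1 ∷ 5 ∷ 6 ∷ [])) ∷
             (leaf (1 ∷ 1 ∷ 5 ∷ 6 ∷ 9 ∷ 14 ∷ 16 ∷ [])) ∷ [])) ∷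
            (leaf (1 ∷ 6 ∷ 8 ∷ 8 ∷ 8 ∷ 8 ∷ 11 ∷ 11 ∷ 13 ∷ 13 ∷ [])) ∷
            (leaf (1 ∷ 6 ∷ 8 ∷ 8 ∷ 8 ∷ 11 ∷ 13 ∷ [])) ∷
            (leaf (1 ∷ 6 ∷ 8 ∷ 8 ∷ 11 ∷ 13 ∷ [])) ∷ []))) ∷ [])))
        (leaf (0 ∷ 0 ∷ 2 ∷ 6 ∷ 12 ∷ []))) ∷
       (apart 4F 5F 3F
        (leaf (0 ∷ 3 ∷ 5 ∷ []))
        (leaf (0 ∷ 2 ∷ 6 ∷ []))) ∷
       (apart 4F 5F 3F
        (leaf (0 ∷ 0 ∷ 3 ∷ 5 ∷ []))
        (leaf (0 ∷ 0 ∷ 2 ∷ 6 ∷ []))) ∷ [])) ∷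
      (edge 1F 3F (0 ∷ 7 ∷ []) (
       (nonedge 1F 0F 3F (0 ∷ 8 ∷ [])
        (leaf (0 ∷ 2 ∷ []))
        (leaf (0 ∷ 3 ∷ []))) ∷
       (leaf (1 ∷ 5 ∷ 6 ∷ 11 ∷ [])) ∷
       (nonedge 1F 2F 3F (0 ∷ 9 ∷ [])
        (leaf (0 ∷ 2 ∷ []))
        (leaf (0 ∷ 3 ∷ []))) ∷
       (apart 3F 4F 5F
        (leaf (0 ∷ 2 ∷ 6 ∷ 12 ∷ []))
        (edge 3F 5F (0 ∷ 1 ∷ 4 ∷ 6 ∷ []) (
         (nonedge 4F 3F 0F (0 ∷ 4 ∷ [])
          (leaf (0 ∷ 2 ∷ 6 ∷ 10 ∷ []))
          (leaf (0 ∷ 3 ∷ 7 ∷ 9 ∷ []))) ∷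
         (leaf (1 ∷ 3 ∷ 7 ∷ 7 ∷ 8 ∷ [])) ∷
         (nonedge 4F 3F 2F (0 ∷ 4 ∷ [])
          (leaf (0 ∷ 2 ∷ 6 ∷ 10 ∷ []))
          (leaf (0 ∷ 3 ∷ 7 ∷ 9 ∷ []))) ∷
         (leaf (1 ∷ 9 ∷ 10 ∷ [])) ∷
         (leaf (1 ∷ 3 ∷ 7 ∷ [])) ∷
         (nonedge 4F 5F 3F (0 ∷ 1 ∷ 2 ∷ 4 ∷ [])
          (leaf (0 ∷ 2 ∷ 6 ∷ 10 ∷ []))
          (leaf (0 ∷ 3 ∷ 7 ∷ 9 ∷ []))) ∷ []))) ∷
       (edge 3F 5F (0 ∷ 3 ∷ 5 ∷ []) (
        (nonedge 1F 0F 1F (0 ∷ 2 ∷ 4 ∷ 5 ∷ 7 ∷ [])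
         (leaf (0 ∷ 2 ∷ 5 ∷ 9 ∷ []))
         (leaf (0 ∷ 1 ∷ []))) ∷
        (leaf (1 ∷ 3 ∷ 4 ∷ 8 ∷ 9 ∷ [])) ∷
        (nonedge 1F 2F 1F (0 ∷ 2 ∷ 4 ∷ 5 ∷ 7 ∷ [])
         (leaf (0 ∷ 2 ∷ 5 ∷ 9 ∷ []))
         (leaf (0 ∷ 1 ∷ []))) ∷
        (leaf (1 ∷ 8 ∷ 9 ∷ [])) ∷
        (leaf (1 ∷ 8 ∷ 12 ∷ [])) ∷
        (leaf (1 ∷ 4 ∷ 8 ∷ 8 ∷ 9 ∷ [])) ∷ [])) ∷
       (apart 3F 4F 5F
        (leaf (0 ∷ 2 ∷ 6 ∷ []))
        (leaf (0 ∷ 3 ∷ 5 ∷ []))) ∷ [])) ∷ []))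
     (leaf (0 ∷ 8 ∷ []))))
   (leaf (0 ∷ 2 ∷ 4 ∷ [])))
  (leaf (0 ∷ 4 ∷ [])))

-- Symmetries of M6

-- Reversals of the two paths of the complement, and their exchange.
flip₁ flip₂ swap : Fin 6 → Fin 6
flip₁ 0F = 2F
flip₁ 1F = 1F
flip₁ 2F = 0F
flip₁ 3F = 3F
flip₁ 4F = 4F
flip₁ 5F = 5F
flip₂ 0F = 0F
flip₂ 1F = 1F
flip₂ 2F = 2F
flip₂ 3F = 5F
flip₂ 4F = 4F
flip₂ 5F = 3F
swap 0F = 3F
swap 1F = 4F
swap 2F = 5F
swap 3F = 0F
swap 4F = 1F
swap 5F = 2F

-- An involution can serve as both maps of `reindex`.
Symmetry : (Fin 6 → Fin 6) → Set
Symmetry σ = (∀ i → σ (σ i) ≡ i) × (∀ i j → M6-adj (σ i) (σ j) ≡ M6-adj i j)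

symmetry? : ∀ σ → Dec (Symmetry σ)
symmetry? σ = Fin.all? (λ i → σ (σ i) Fin.≟ i) ×-dec
              Fin.all? (λ i → Fin.all? λ j → M6-adj (σ i) (σ j) 𝔹.≟ M6-adj i j)

relabel : ∀ {S σ} → Symmetry σ → Labels M6 S → Labels M6 (S ∘ σ)
relabel {S} {σ} (involutive , automorphism) labels =
  reindex M6 M6 {S} {π = ⤖-id _} labels σ σ involutive involutive automorphism

-- Reduction to a sorted labelling

-- A pair (i , j) stands for `S j ≤ S i`. The first two pairs orient the paths; with them, the other
-- three suffice to make vertex 0, respectively 1, a maximum among all six. The order of the pairs
-- fixes the positions at the root of the certificates.
order₀ order₁ : List (Fin 6 × Fin 6)
order₀ = (0F , 2F) ∷ (3F , 5F) ∷ (0F , 1F) ∷ (0F , 3F) ∷ (0F , 4F) ∷ []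
order₁ = (0F , 2F) ∷ (3F , 5F) ∷ (1F , 0F) ∷ (1F , 3F) ∷ (1F , 4F) ∷ []

descents : List (Fin 6 × Fin 6) → List (Form 6)
descents = map λ (i , j) → var i ≽ var j

-- For a concrete certificate the type `T (refutes …)` computes to the unit type, so giving `tt`
-- makes the type checker run the certificate.
refuted-by : ∀ S is c → T (refutes M6 (descents is) c) → Labels M6 S → ¬ All (λ (i , j) → S j ℤ.≤ S i) is
refuted-by S is c ok labels hs = refutes-sound M6 {S} labels c ok
  (All.map⁺ (All.map (λ { {i , j} → ≽-intro (var i) (var j) (⟦var⟧ i S) (⟦var⟧ j S) }) hs))

-- With both paths sorted, `S 0F ⊔ S 1F` and `S 3F ⊔ S 4F` are the maxima over the two paths, so the
-- overall maximum lies at 0 or 1.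
refuted-sorted : ∀ S → Labels M6 S → S 2F ℤ.≤ S 0F → S 5F ℤ.≤ S 3F → ¬ S 3F ⊔ S 4F ℤ.≤ S 0F ⊔ S 1F
refuted-sorted S labels a b m with ℤ.≤-total (S 1F) (S 0F)
... | inj₁ le = refuted-by S order₀ max-at-0 tt labels
  (a ∷ b ∷ le ∷ ℤ.≤-trans (ℤ.i≤i⊔j _ _) m′ ∷ ℤ.≤-trans (ℤ.i≤j⊔i (S 3F) _) m′ ∷ [])
  where m′ = subst (S 3F ⊔ S 4F ℤ.≤_) (ℤ.i≥j⇒i⊔j≡i le) m
... | inj₂ le = refuted-by S order₁ max-at-1 tt labels
  (a ∷ b ∷ le ∷ ℤ.≤-trans (ℤ.i≤i⊔j _ _) m′ ∷ ℤ.≤-trans (ℤ.i≤j⊔i (S 3F) _) m′ ∷ [])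
  where m′ = subst (S 3F ⊔ S 4F ℤ.≤_) (ℤ.i≤j⇒i⊔j≡j le) m

refuted-both-sorted : ∀ S → Labels M6 S → S 2F ℤ.≤ S 0F → ¬ S 5F ℤ.≤ S 3F
refuted-both-sorted S labels a b with ℤ.≤-total (S 3F ⊔ S 4F) (S 0F ⊔ S 1F)
... | inj₁ le = refuted-sorted S labels a b le
-- Exchanging the paths exchanges the two sorting hypotheses `a` and `b`.
... | inj₂ le = refuted-sorted (S ∘ swap) (relabel (from-yes (symmetry? swap)) labels) b a le

refuted-left-sorted : ∀ S → Labels M6 S → ¬ S 2F ℤ.≤ S 0F
refuted-left-sorted S labels a with ℤ.≤-total (S 5F) (S 3F)
... | inj₁ le = refuted-both-sorted S labels a le
-- `flip₂` fixes 0, 1 and 2, so `a` survives the relabelling.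
... | inj₂ le = refuted-both-sorted (S ∘ flip₂) (relabel (from-yes (symmetry? flip₂)) labels) a le

refuted : ∀ S → ¬ Labels M6 S
refuted S labels with ℤ.≤-total (S 2F) (S 0F)
... | inj₁ le = refuted-left-sorted S labels le
... | inj₂ le = refuted-left-sorted (S ∘ flip₁) (relabel (from-yes (symmetry? flip₁)) labels) le

-- Graphs with at most five vertices

-- Halving the candidates test by test covers all 2 ^ length is patterns
-- without comparing each pattern with each candidate.
shatters : {A I : Set} → (I → A → Bool) → List I → List A → Bool
shatters p []       xs = not (null xs)
shatters p (i ∷ is) xs = shatters p is (filterᵇ (p i) xs) ∧ shatters p is (filterᵇ (not ∘ p i) xs)

-- The pattern `f` selects one of the two filtered lists at every test; a candidate left at the end
-- has passed every filter on the way.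
shatters-sound : ∀ {A I : Set} (p : I → A → Bool) is xs → T (shatters p is xs) → (f : I → Bool) →
                 ∃[ x ] x ∈ xs × All (λ i → p i x ≡ f i) is
shatters-sound p []       (x ∷ xs) _  f = x , here refl , []
shatters-sound p (i ∷ is) xs       ok f with Equivalence.to 𝔹.T-∧ ok | f i in fi
... | okᵗ , okᶠ | true  = let x , x∈ , all = shatters-sound p is _ okᵗ f
                              x∈xs , pix = ∈-filter⁻ (T? ∘ p i) x∈
                          in x , x∈xs , trans (Equivalence.to 𝔹.T-≡ pix) (≡.sym fi) ∷ all
... | okᵗ , okᶠ | false = let x , x∈ , all = shatters-sound p is _ okᶠ f
                              x∈xs , pix = ∈-filter⁻ (T? ∘ not ∘ p i) x∈
                          in x , x∈xs , trans (Equivalence.to 𝔹.T-not-≡ pix) (≡.sym fi) ∷ all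

values : ∀ {n} → Vec ℕ n → Fin n → ℤ
values v i = + lookup v i

joined? : ∀ {m} (S : Fin m → ℤ) i j → Dec ((+ ∣ S i - S j ∣) ∈S S)
joined? S i j = Fin.any? λ k → S k ℤ.≟ + ∣ S i - S j ∣

joined : ∀ {n} → Fin n × Fin n → Vec ℕ n → Bool
joined (i , j) v = ⌊ joined? (values v) i j ⌋

_ascends? : ∀ {n} ((i , j) : Fin n × Fin n) → Dec (i Fin.< j)
(i , j) ascends? = i Fin.<? j

-- Each unordered pair occurs once. Listing both orders would demand asymmetric patterns, which no
-- signature realises.
ascending : ∀ n → List (Fin n × Fin n)
ascending n = filter _ascends? (cartesianProduct (allFin n) (allFin n))

Agrees : ∀ {n} → Graph n → Vec ℕ n → Set
Agrees {n} G v = All (λ (i , j) → joined (i , j) v ≡ adj G i j) (ascending n)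

agrees⇒iff : ∀ {n} (G : Graph n) v → Agrees G v → ∀ {i j} → i Fin.< j →
             adj G i j ≡ true ⇔ (+ ∣ values v i - values v j ∣) ∈S values v
agrees⇒iff G v agrees {i} {j} i<j = mk⇔
  (λ a → toWitness {a? = v-joined?} (Equivalence.from 𝔹.T-≡ (trans eq a)))
  (λ x∈S → trans (≡.sym eq) (Equivalence.to 𝔹.T-≡ (fromWitness {a? = v-joined?} x∈S)))
  where
  v-joined? = joined? (values v) i j
  eq : joined (i , j) v ≡ adj G i j
  eq = All.lookup agrees (∈-filter⁺ _ascends? (∈-cartesianProduct⁺ (∈-allFin i) (∈-allFin j)) i<j)

agrees⇒labels : ∀ {n} (G : Graph n) v → Agrees G v → Labels G (values v)
agrees⇒labels G v agrees i j i≢j with Fin.<-cmp i j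
... | tri< i<j _ _ = agrees⇒iff G v agrees i<j
... | tri≈ _ i≡j _ = contradiction i≡j i≢j
... | tri> _ _ j<i = subst₂ (λ b d → (b ≡ true) ⇔ ((+ d) ∈S values v))
  (sym G j i) (ℤ.∣i-j∣≡∣j-i∣ (values v j) (values v i)) (agrees⇒iff G v agrees j<i)

-- The adjacency of `G` on ascending pairs is one of the patterns that the candidates cover.
shattered⇒autograph : ∀ {n} (vs : List (Vec ℕ n)) → T (shatters joined (ascending n) vs) →
                      (G : Graph n) → IsAutograph G
shattered⇒autograph vs ok G =
  let v , _ , agrees = shatters-sound joined (ascending _) vs ok (λ (i , j) → adj G i j)
  in labels⇒autograph {G = G} (values v , agrees⇒labels G v agrees)

-- Stopping in front of an element equal to x lists each permutation once.
insertions : ∀ {n} → ℕ → Vec ℕ n → List (Vec ℕ (suc n))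
insertions x []       = (x ∷ []) ∷ []
insertions x (y ∷ ys) = (x ∷ y ∷ ys) ∷ (if x ℕ.≡ᵇ y then [] else map (y ∷_) (insertions x ys))

permutations : ∀ {n} → Vec ℕ n → List (Vec ℕ n)
permutations []       = [] ∷ []
permutations (x ∷ xs) = concatMap (insertions x) (permutations xs)

-- One signature for each isomorphism class of graphs on n vertices.
signatures : ∀ n → List (Vec ℕ n)
signatures 0 =
  [] ∷ []
signatures 1 =
  (0 ∷ []) ∷ []
signatures 2 =
  (1 ∷ 1 ∷ []) ∷ (0 ∷ 0 ∷ []) ∷ []
signatures 3 =
  (1 ∷ 1 ∷ 1 ∷ []) ∷ (1 ∷ 2 ∷ 5 ∷ []) ∷ (0 ∷ 1 ∷ 3 ∷ []) ∷ (0 ∷ 0 ∷ 0 ∷ []) ∷ []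
signatures 4 =
  (1 ∷ 1 ∷ 1 ∷ 1 ∷ []) ∷ (1 ∷ 1 ∷ 3 ∷ 6 ∷ []) ∷ (1 ∷ 1 ∷ 2 ∷ 5 ∷ []) ∷ (0 ∷ 1 ∷ 3 ∷ 5 ∷ []) ∷
  (1 ∷ 2 ∷ 3 ∷ 7 ∷ []) ∷ (1 ∷ 2 ∷ 5 ∷ 10 ∷ []) ∷ (1 ∷ 2 ∷ 4 ∷ 8 ∷ []) ∷ (0 ∷ 1 ∷ 1 ∷ 3 ∷ []) ∷
  (1 ∷ 1 ∷ 2 ∷ 2 ∷ []) ∷ (0 ∷ 0 ∷ 1 ∷ 3 ∷ []) ∷ (0 ∷ 0 ∷ 0 ∷ 0 ∷ []) ∷ []
signatures 5 =
  (1 ∷ 1 ∷ 1 ∷ 1 ∷ 1 ∷ []) ∷ (1 ∷ 1 ∷ 1 ∷ 3 ∷ 6 ∷ []) ∷ (1 ∷ 1 ∷ 2 ∷ 5 ∷ 5 ∷ []) ∷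
  (1 ∷ 1 ∷ 1 ∷ 2 ∷ 5 ∷ []) ∷ (0 ∷ 1 ∷ 3 ∷ 5 ∷ 7 ∷ []) ∷ (1 ∷ 1 ∷ 3 ∷ 6 ∷ 9 ∷ []) ∷
  (2 ∷ 4 ∷ 5 ∷ 10 ∷ 11 ∷ []) ∷ (1 ∷ 2 ∷ 4 ∷ 8 ∷ 11 ∷ []) ∷ (1 ∷ 2 ∷ 3 ∷ 6 ∷ 10 ∷ []) ∷
  (1 ∷ 1 ∷ 2 ∷ 5 ∷ 10 ∷ []) ∷ (1 ∷ 1 ∷ 2 ∷ 4 ∷ 8 ∷ []) ∷ (0 ∷ 1 ∷ 1 ∷ 3 ∷ 5 ∷ []) ∷
  (1 ∷ 1 ∷ 2 ∷ 2 ∷ 5 ∷ []) ∷ (1 ∷ 1 ∷ 2 ∷ 3 ∷ 7 ∷ []) ∷ (1 ∷ 2 ∷ 4 ∷ 7 ∷ 11 ∷ []) ∷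
  (1 ∷ 2 ∷ 5 ∷ 7 ∷ 9 ∷ []) ∷ (1 ∷ 1 ∷ 2 ∷ 5 ∷ 6 ∷ []) ∷ (0 ∷ 1 ∷ 2 ∷ 4 ∷ 7 ∷ []) ∷
  (1 ∷ 1 ∷ 1 ∷ 2 ∷ 2 ∷ []) ∷ (0 ∷ 0 ∷ 1 ∷ 3 ∷ 5 ∷ []) ∷ (1 ∷ 2 ∷ 3 ∷ 4 ∷ 9 ∷ []) ∷
  (3 ∷ 4 ∷ 6 ∷ 8 ∷ 9 ∷ []) ∷ (1 ∷ 2 ∷ 3 ∷ 7 ∷ 8 ∷ []) ∷ (1 ∷ 2 ∷ 3 ∷ 5 ∷ 10 ∷ []) ∷
  (0 ∷ 1 ∷ 1 ∷ 1 ∷ 3 ∷ []) ∷ (0 ∷ 1 ∷ 1 ∷ 3 ∷ 3 ∷ []) ∷ (1 ∷ 2 ∷ 4 ∷ 8 ∷ 9 ∷ []) ∷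
  (1 ∷ 2 ∷ 3 ∷ 6 ∷ 7 ∷ []) ∷ (0 ∷ 1 ∷ 2 ∷ 4 ∷ 8 ∷ []) ∷ (1 ∷ 2 ∷ 2 ∷ 4 ∷ 6 ∷ []) ∷
  (0 ∷ 0 ∷ 1 ∷ 1 ∷ 3 ∷ []) ∷ (0 ∷ 1 ∷ 2 ∷ 4 ∷ 5 ∷ []) ∷ (0 ∷ 0 ∷ 0 ∷ 1 ∷ 3 ∷ []) ∷
  (0 ∷ 0 ∷ 0 ∷ 0 ∷ 0 ∷ []) ∷ []
signatures _ = []

-- Splitting into numerals makes each `shatters` test a closed term that evaluates to `true`. The
-- largest, for five vertices, has ten pairs and so 1024 patterns.
small-autograph : ∀ n → n ≤ 5 → (G : Graph n) → IsAutograph G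
small-autograph 0 _ = shattered⇒autograph (concatMap permutations (signatures 0)) tt
small-autograph 1 _ = shattered⇒autograph (concatMap permutations (signatures 1)) tt
small-autograph 2 _ = shattered⇒autograph (concatMap permutations (signatures 2)) tt
small-autograph 3 _ = shattered⇒autograph (concatMap permutations (signatures 3)) tt
small-autograph 4 _ = shattered⇒autograph (concatMap permutations (signatures 4)) tt
small-autograph 5 _ = shattered⇒autograph (concatMap permutations (signatures 5)) tt
small-autograph (suc (suc (suc (suc (suc (suc _)))))) (s≤s (s≤s (s≤s (s≤s (s≤s ())))))

theorem1 : (¬ IsAutograph M6) × (∀ (n : ℕ) → n ≤ 5 → (G : Graph n) → IsAutograph G)
theorem1 = (λ autograph → let S , labels = autograph⇒labels {G = M6} autograph in refuted S labels) , small-autograph
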